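{- Let $\alpha_1,\ldots,\alpha_n$ be positive real numbers and $b_1,\ldots,b_n$ integers. Let $A_1,\ldots,A_n$ be finite subsets of $\mathbb{Z}$ each of cardinality $k>0$. For $1\leqslant i<j\leqslant n$ let $m_{ij}$ be an integer greater than $2\max\{|x_i-x_j|:\ x_i\in A_i,\ x_j\in A_j\}$. Then the set $$\Big\{\sum_{i=1}^n a_i:\ a_i\in A_i \text{ for all } i,\ a_i\alpha_i\neq a_j\alpha_j \text{ and } a_i+b_i\not\equiv a_j+b_j \pmod{m_{ij}} \text{ whenever } i<j\Big\}$$ has more than $(k-n)n$ elements. -}

module Defs where

open import Level using (Level; _⊔_; suc)
open import Data.Nat as ℕ using (ℕ; zero)
open import Data.Integer as ℤ using (ℤ; +_; -[1+_])
open import Data.Fin using (Fin)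
open import Data.Product using (∃)
open import Relation.Nullary using (¬_)
open import Relation.Binary using (Rel; IsStrictTotalOrder)
open import Algebra.Bundles using (CommutativeRing)

-- An ordered field (the real numbers ℝ are the motivating model; the
-- standard library has no reals).  Standard axioms: a commutative ring
-- with a strict total order compatible with + and *, 0 < 1, and
-- multiplicative inverses for nonzero elements.
record OrderedField (c ℓ₁ ℓ₂ : Level) : Set (suc (c ⊔ ℓ₁ ⊔ ℓ₂)) where
  field
    commutativeRing : CommutativeRing c ℓ₁
  open CommutativeRing commutativeRing public
  field
    _<_ : Rel Carrier ℓ₂
    isStrictTotalOrder : IsStrictTotalOrder _≈_ _<_
    +-monoˡ-< : ∀ {x y} z → x < y → (x + z) < (y + z)
    *-pos : ∀ {x y} → 0# < x → 0# < y → 0# < (x * y)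
    0<1 : 0# < 1#
    inverse : ∀ x → ¬ (x ≈ 0#) → ∃ λ y → (x * y) ≈ 1#

  fromℕ : ℕ → Carrier
  fromℕ zero = 0#
  fromℕ (ℕ.suc n) = 1# + fromℕ n

  fromℤ : ℤ → Carrier
  fromℤ (+ n) = fromℕ n
  fromℤ -[1+ n ] = - fromℕ (ℕ.suc n)

sumℤ : ∀ {n} → (Fin n → ℤ) → ℤ
sumℤ {zero} a = + 0
sumℤ {ℕ.suc n} a = a Fin.zero ℤ.+ sumℤ (λ i → a (Fin.suc i))
  where import Data.Fin as Fin

{-# OPTIONS --safe #-}
module Submission where

-- Each congruence condition excludes at most one value c of aᵢ − aⱼ, because |aᵢ − aⱼ| < mᵢⱼ/2. If the
-- restricted sums were contained in a multiset S of N = (k − n)n integers, the polynomial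
--   ∏_{i<j} (αᵢxᵢ − αⱼxⱼ)(xᵢ − xⱼ − cᵢⱼ) · ∏_{s∈S} (x₁ + ⋯ + xₙ − s)
-- of degree n(k−1) would vanish on A₁ × ⋯ × Aₙ. Its iterated divided difference over this grid is the
-- coefficient of ∏ xᵢ^(k−1), which depends neither on the nodes nor on the constants c and s; hence it may be
-- evaluated on other grids. On {0,…,k−1}ⁿ the sums can be chosen to leave only the arrangements of 0,…,n−1,
-- which reduces the coefficient, up to a nonzero factor, to the case k = n; there, on nodes 1, M, M², … with M
-- large, all surviving terms have the same sign, so the coefficient is nonzero.

open import Defs
open import Level using (Level)
open import Function using (_∘_)
open import Function.Definitions using (Injective)
open import Data.Nat as ℕ using (ℕ; zero; suc; z≤n; s≤s)
import Data.Nat.Properties as ℕ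
import Data.Nat.Divisibility as ℕ
open import Data.Nat.Solver using () renaming (module +-*-Solver to ℕ-Solver)
open import Data.Integer as ℤ using (ℤ; +_; -[1+_]; ∣_∣)
import Data.Integer.Properties as ℤ
open import Data.Integer.Divisibility using (_∣_)
import Data.Integer.Divisibility.Signed as Signed
open import Data.Integer.Solver using () renaming (module +-*-Solver to ℤ-Solver)
open import Data.Fin as Fin using (Fin; zero; suc; toℕ)
import Data.Fin.Properties as Fin
open import Data.Maybe using (Maybe; just; nothing; maybe)
open import Data.List using (List; []; _∷_; _++_; length; map; upTo; allFin; replicate; filter; deduplicate; cartesianProductWith)
open import Data.List.Properties using (length-map; length-++; length-tabulate; length-upTo; length-replicate; map-++; map-∘)
open import Data.List.Membership.Propositional using (_∈_; find; lose)
open import Data.List.Membership.Propositional.Properties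
  using (∈-map⁺; ∈-map⁻; ∈-++⁺ˡ; ∈-++⁺ʳ; ∈-++⁻; ∈-allFin; ∈-upTo⁺; ∈-filter⁺; ∈-filter⁻;
         ∈-deduplicate⁺; ∈-deduplicate⁻; ∈-cartesianProductWith⁺; ∈-cartesianProductWith⁻)
open import Data.List.Relation.Unary.All as All using (All)
open import Data.List.Relation.Unary.AllPairs using ([]; _∷_)
open import Data.List.Relation.Unary.Any as Any using (here; there)
open import Data.List.Relation.Unary.Unique.Propositional using (Unique)
open import Data.List.Relation.Unary.Unique.DecPropositional.Properties ℤ._≟_ using (deduplicate-!)
open import Data.Vec as Vec using (Vec; []; _∷_)
open import Data.Vec.Properties using (map-replicate; lookup∘tabulate)
open import Data.Vec.Relation.Unary.All using ([]; _∷_) renaming (All to AllVec)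
open import Data.Vec.Relation.Unary.All.Properties using (tabulate⁺)
open import Data.Vec.Functional using (removeAt) renaming ([] to ⟨⟩; _∷_ to _◂_)
open import Data.Product using (∃; ∃₂; _×_; _,_; proj₁; proj₂)
open import Data.Sum using (_⊎_; inj₁; inj₂)
open import Data.Empty using (⊥-elim)
open import Relation.Nullary using (¬_; Dec; yes; no; ¬?; _×-dec_; _⊎-dec_)
open import Relation.Binary using (IsStrictTotalOrder; tri<; tri≈; tri>)
open import Relation.Binary.PropositionalEquality as ≡ using (_≡_)
open import Algebra.Solver.Ring.AlmostCommutativeRing using (fromCommutativeRing; _-Raw-AlmostCommutative⟶_)
open import Algebra.Properties.CommutativeMonoid.Sum ℕ.+-0-commutativeMonoid
  using () renaming (sum to sumℕ; sum-remove to sumℕ-remove)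

-- No polynomial ring is built. The product stays a list of affine forms and `coeff` is a recursion
-- on that list, so every statement about degrees becomes a count of forms against nodes. The count
-- is tight: k nodes on an axis read off the exponent k - 1, and two forms per pair together with N
-- shifts make exactly n(k - 1). The number N = (k - n)n is also the distance between the least and
-- the greatest sum of n distinct elements of {0,...,k-1}; hence N shifts are just enough to kill
-- every sum but one. Neither grid is enough alone. The nodes 0,...,k-1 control the sums, but their
-- terms may have either sign; the powers of M control the signs, but not the sums. For k = n there
-- are no shifts, so there the two grids can be compared directly. The signs agree because each pair
-- contributes two factors: once M exceeds all ratios αⱼ/αᵢ, which are positive, αᵢxᵢ - αⱼxⱼ and xᵢ
-- - xⱼ have the same sign, so the sign of an arrangement enters twice.

-- Counting pairs, degrees and sums of distinct natural numbers.

module Injections where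
  open import Data.Nat using (_≤_; _<_; _+_; _*_; _∸_)
  open ≡ using (refl)

  -- The binomial coefficient n(n - 1)/2: the number of pairs i < j, and the least sum of n distinct
  -- natural numbers.
  triangle : ℕ → ℕ
  triangle zero    = 0
  triangle (suc n) = n + triangle n

  triangle-double : ∀ n → triangle n + triangle n + n ≡ n * n
  triangle-double zero    = refl
  triangle-double (suc n) = begin
    (n + t) + (n + t) + suc n    ≡⟨ solve 2 (λ n t → (n :+ t) :+ (n :+ t) :+ (con 1 :+ n) := con 1 :+ n :+ (n :+ (t :+ t :+ n))) refl n t ⟩
    suc n + (n + (t + t + n))    ≡⟨ ≡.cong (λ z → suc n + (n + z)) (triangle-double n) ⟩
    suc n + (n + n * n)          ≡⟨ ≡.cong (suc n ℕ.+_) (ℕ.*-suc n n) ⟨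
    suc n + n * suc n            ∎
    where
    open ≡.≡-Reasoning
    open ℕ-Solver
    t = triangle n

  -- The left side counts the forms of the product, two per pair and (d + 1 - n)n shifts; the right
  -- side is the total degree of ∏ xᵢᵈ.
  degree-count : ∀ {n d} → n ≤ suc d → triangle n + (triangle n + (suc d ∸ n) * n) ≡ n * d
  -- Adding n completes the two triangles to n², which avoids halving and subtracting.
  degree-count {n} {d} n≤1+d = ℕ.+-cancelˡ-≡ n _ _ (begin
    n + (t + (t + r * n))  ≡⟨ solve 3 (λ n t r → n :+ (t :+ (t :+ r :* n)) := (t :+ t :+ n) :+ r :* n) refl n t r ⟩
    (t + t + n) + r * n    ≡⟨ ≡.cong (_+ r * n) (triangle-double n) ⟩
    n * n + r * n          ≡⟨ ℕ.*-distribʳ-+ n n r ⟨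
    (n + r) * n            ≡⟨ ≡.cong (_* n) (ℕ.m+[n∸m]≡n n≤1+d) ⟩
    suc d * n              ≡⟨ ℕ.*-comm (suc d) n ⟩
    n * suc d              ≡⟨ ℕ.*-suc n d ⟩
    n + n * d              ∎)
    where
    open ≡.≡-Reasoning
    open ℕ-Solver
    t = triangle n
    r = suc d ∸ n

  sum-replicate : ∀ n d → Vec.sum (Vec.replicate n d) ≡ n * d
  sum-replicate zero    d = refl
  sum-replicate (suc n) d = ≡.cong (d ℕ.+_) (sum-replicate n d)

  pairs : ∀ n → List (Fin n × Fin n)
  pairs zero    = []
  pairs (suc n) = map (λ j → zero , suc j) (allFin n) ++ map (λ (i , j) → suc i , suc j) (pairs n)

  length-pairs : ∀ n → length (pairs n) ≡ triangle n
  length-pairs zero    = refl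
  length-pairs (suc n) = ≡.trans (length-++ (map (λ j → zero , suc j) (allFin n)))
    (≡.cong₂ _+_ (≡.trans (length-map _ (allFin n)) (length-tabulate {n = n} (λ i → i))) (≡.trans (length-map _ (pairs n)) (length-pairs n)))

  ∈-pairs : ∀ {n} {i j : Fin n} → i Fin.< j → (i , j) ∈ pairs n
  ∈-pairs {i = zero}  {suc j} _         = ∈-++⁺ˡ (∈-map⁺ _ (∈-allFin j))
  ∈-pairs {i = suc i} {suc j} (s≤s i<j) = ∈-++⁺ʳ (map _ (allFin _)) (∈-map⁺ _ (∈-pairs i<j))

  ∈-pairs⁻ : ∀ {n} {i j : Fin n} → (i , j) ∈ pairs n → i Fin.< j
  ∈-pairs⁻ {suc n} p with ∈-++⁻ (map _ (allFin n)) p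
  ... | inj₁ q with ∈-map⁻ _ q
  ...   | _ , _ , refl = s≤s z≤n
  ∈-pairs⁻ {suc n} p | inj₂ q with ∈-map⁻ _ q
  ...   | _ , r , refl = s≤s (∈-pairs⁻ r)

  Inj : ∀ {n} → (Fin n → ℕ) → Set
  Inj a = Injective _≡_ _≡_ a

  -- The case split behind all later grid sums: at a collision the product of pair forms vanishes,
  -- so only injective assignments matter.
  injective⊎collision : ∀ {n} (a : Fin n → ℕ) → Inj a ⊎ ∃₂ λ i j → i Fin.< j × a i ≡ a j
  injective⊎collision a with Fin.any? (λ i → Fin.any? (λ j → (i Fin.<? j) ×-dec (a i ℕ.≟ a j)))
  ... | yes (i , j , i<j , eq) = inj₂ (i , j , i<j , eq)
  ... | no ¬collision = inj₁ injective
    where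
    injective : Inj a
    injective {i} {j} eq with Fin.<-cmp i j
    ... | tri< i<j _ _ = ⊥-elim (¬collision (i , j , i<j , eq))
    ... | tri≈ _ i≡j _ = i≡j
    ... | tri> _ _ j<i = ⊥-elim (¬collision (j , i , j<i , ≡.sym eq))

  removeAt-injective : ∀ {n} {a : Fin (suc n) → ℕ} → Inj a → ∀ i → Inj (removeAt a i)
  removeAt-injective inj i eq = Fin.punchIn-injective i _ _ (inj eq)

  removeAt-< : ∀ {n k} {a : Fin (suc n) → ℕ} → Inj a → (∀ i → a i < suc k) → ∀ {i} → a i ≡ k → ∀ j → removeAt a i j < k
  removeAt-< inj bound {i} eq j = ℕ.≤∧≢⇒< (ℕ.≤-pred (bound (Fin.punchIn i j)))
    (λ eq′ → Fin.punchInᵢ≢i i j (inj (≡.trans eq′ (≡.sym eq))))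

  ≢⇒< : ∀ {n k} {a : Fin n → ℕ} → (∀ i → a i < suc k) → ¬ (∃ λ i → a i ≡ k) → ∀ i → a i < k
  ≢⇒< bound ¬top i = ℕ.≤∧≢⇒< (ℕ.≤-pred (bound i)) (λ eq → ¬top (i , eq))

  injective-≤ : ∀ k {n} (a : Fin n → ℕ) → Inj a → (∀ i → a i < k) → n ≤ k
  injective-≤ k a inj bound = Fin.injective⇒≤ {f = λ i → Fin.fromℕ< (bound i)} (λ eq →
    inj (≡.trans (≡.sym (Fin.toℕ-fromℕ< (bound _))) (≡.trans (≡.cong Fin.toℕ eq) (Fin.toℕ-fromℕ< (bound _)))))

  -- Induction on the bound: either the top value k is missed and the bound drops, or injectivity
  -- puts it at a single index, whose removal lowers both n and the bound. In that case n ≤ k by the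
  -- pigeonhole principle.
  triangle≤sum : ∀ k {n} (a : Fin n → ℕ) → Inj a → (∀ i → a i < k) → triangle n ≤ sumℕ a
  triangle≤sum zero    {zero}  a inj bound = z≤n
  triangle≤sum zero    {suc n} a inj bound with () ← bound zero
  triangle≤sum (suc k)         a inj bound with Fin.any? (λ i → a i ℕ.≟ k)
  ... | no ¬top = triangle≤sum k a inj (≢⇒< bound ¬top)
  triangle≤sum (suc k) {suc n} a inj bound | yes (i , eq) = ≡.subst (n + triangle n ≤_) (≡.sym (sumℕ-remove a))
    (ℕ.+-mono-≤ (ℕ.≤-trans (injective-≤ k _ (removeAt-injective inj i) rest) (ℕ.≤-reflexive (≡.sym eq)))
                (triangle≤sum k _ (removeAt-injective inj i) rest))
    where rest = removeAt-< inj bound eq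

  -- The extreme case is k-n, ..., k-1, which is 0, ..., n-1 with each of the n values raised by k -
  -- n.
  sum≤triangle : ∀ k {n} (a : Fin n → ℕ) → Inj a → (∀ i → a i < k) → sumℕ a ≤ triangle n + (k ∸ n) * n
  sum≤triangle zero    {zero}  a inj bound = z≤n
  sum≤triangle zero    {suc n} a inj bound with () ← bound zero
  sum≤triangle (suc k) {n}     a inj bound with Fin.any? (λ i → a i ℕ.≟ k)
  ... | no ¬top = ℕ.≤-trans (sum≤triangle k a inj (≢⇒< bound ¬top))
                    (ℕ.+-monoʳ-≤ (triangle n) (ℕ.*-monoˡ-≤ n (ℕ.∸-monoˡ-≤ n (ℕ.n≤1+n k))))
  sum≤triangle (suc k) {suc n} a inj bound | yes (i , eq) = begin
    sumℕ a                                    ≡⟨ sumℕ-remove a ⟩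
    a i + sumℕ (removeAt a i)                 ≡⟨ ≡.cong (_+ sumℕ (removeAt a i)) (≡.trans eq (≡.sym (ℕ.m+[n∸m]≡n n≤k))) ⟩
    (n + r) + sumℕ (removeAt a i)             ≤⟨ ℕ.+-monoʳ-≤ (n + r) (sum≤triangle k _ (removeAt-injective inj i) rest) ⟩
    (n + r) + (triangle n + r * n)            ≡⟨ solve 3 (λ n r t → (n :+ r) :+ (t :+ r :* n) := (n :+ t) :+ r :* (con 1 :+ n)) refl n r (triangle n) ⟩
    (n + triangle n) + r * suc n              ∎
    where
    open ℕ.≤-Reasoning
    open ℕ-Solver
    rest = removeAt-< inj bound eq
    n≤k = injective-≤ k _ (removeAt-injective inj i) rest
    r = k ∸ n

  -- If the top value k is attained, the remaining values already sum to at least their own triangle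
  -- number, which leaves no room for k to exceed the new n.
  sum≡triangle⇒< : ∀ k {n} (a : Fin n → ℕ) → Inj a → (∀ i → a i < k) → sumℕ a ≡ triangle n → ∀ i → a i < n
  sum≡triangle⇒< zero    {suc n} a inj bound _ with () ← bound zero
  sum≡triangle⇒< (suc k) {n}     a inj bound s≡t with Fin.any? (λ i → a i ℕ.≟ k)
  ... | no ¬top = sum≡triangle⇒< k a inj (≢⇒< bound ¬top) s≡t
  sum≡triangle⇒< (suc k) {suc n} a inj bound s≡t | yes (i , eq) = λ j → ℕ.≤-trans (bound j) (s≤s k≤n)
    where
    open ℕ.≤-Reasoning
    rest = removeAt-< inj bound eq
    k≤n : k ≤ n
    k≤n = ℕ.+-cancelʳ-≤ (triangle n) k n (begin
      k + triangle n             ≤⟨ ℕ.+-mono-≤ (ℕ.≤-reflexive (≡.sym eq)) (triangle≤sum k _ (removeAt-injective inj i) rest) ⟩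
      a i + sumℕ (removeAt a i)  ≡⟨ sumℕ-remove a ⟨
      sumℕ a                     ≡⟨ s≡t ⟩
      n + triangle n             ∎)

  injective⇒top : ∀ {n} (a : Fin (suc n) → ℕ) → Inj a → (∀ i → a i < suc n) → ∃ λ i → a i ≡ n
  injective⇒top {n} a inj bound with Fin.any? (λ i → a i ℕ.≟ n)
  ... | yes top = top
  ... | no ¬top = ⊥-elim (ℕ.<-irrefl refl (injective-≤ n a inj (≢⇒< bound ¬top)))

-- Finite sets of integers and the congruence conditions.

module Integers where
  open ≡ using (refl)

  -- Total, with a default past the end, so that it can serve as the node function of an axis.
  nth : List ℤ → ℕ → ℤ
  nth []       _       = + 0
  nth (x ∷ xs) zero    = x
  nth (x ∷ xs) (suc v) = nth xs v

  nth-∈ : ∀ xs {v} → v ℕ.< length xs → nth xs v ∈ xs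
  nth-∈ (x ∷ xs) {zero}  _         = here refl
  nth-∈ (x ∷ xs) {suc v} (s≤s v<l) = there (nth-∈ xs v<l)

  nth-injective : ∀ {xs} → Unique xs → ∀ u v → u ℕ.< length xs → v ℕ.< length xs → nth xs u ≡ nth xs v → u ≡ v
  nth-injective (x∉ ∷ uniq) zero    zero    _         _         _  = refl
  nth-injective (x∉ ∷ uniq) zero    (suc v) _         (s≤s v<l) eq = ⊥-elim (All.lookup x∉ (nth-∈ _ v<l) eq)
  nth-injective (x∉ ∷ uniq) (suc u) zero    (s≤s u<l) _         eq = ⊥-elim (All.lookup x∉ (nth-∈ _ u<l) (≡.sym eq))
  nth-injective (x∉ ∷ uniq) (suc u) (suc v) (s≤s u<l) (s≤s v<l) eq = ≡.cong suc (nth-injective uniq u v u<l v<l eq)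

  choices : ∀ {n} → (Fin n → List ℤ) → List (Fin n → ℤ)
  choices {zero}  A = ⟨⟩ ∷ []
  choices {suc n} A = cartesianProductWith _◂_ (A zero) (choices (A ∘ suc))

  ∈-choices⁻ : ∀ {n} (A : Fin n → List ℤ) {a} → a ∈ choices A → ∀ i → a i ∈ A i
  ∈-choices⁻ {suc n} A a∈ i with ∈-cartesianProductWith⁻ _◂_ (A zero) (choices (A ∘ suc)) a∈
  ∈-choices⁻ {suc n} A a∈ zero    | _ , _ , x∈ , _  , refl = x∈
  ∈-choices⁻ {suc n} A a∈ (suc i) | _ , _ , _  , b∈ , refl = ∈-choices⁻ (A ∘ suc) b∈ i

  -- Membership in `choices A` concerns functions up to `_≡_`, while `a` is only known to agree
  -- pointwise with an enumerated one; hence the representative `b`.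
  ∈-choices⁺ : ∀ {n} (A : Fin n → List ℤ) (a : Fin n → ℤ) → (∀ i → a i ∈ A i) → ∃ λ b → b ∈ choices A × (∀ i → b i ≡ a i)
  ∈-choices⁺ {zero}  A a a∈ = ⟨⟩ , here refl , λ ()
  ∈-choices⁺ {suc n} A a a∈ with ∈-choices⁺ (A ∘ suc) (a ∘ suc) (a∈ ∘ suc)
  ... | b , b∈ , b≗a = a zero ◂ b , ∈-cartesianProductWith⁺ _◂_ (a∈ zero) b∈ , λ { zero → refl ; (suc i) → b≗a i }

  _∣?_ : ∀ m i → Dec (m ∣ i)
  m ∣? i = ∣ m ∣ ℕ.∣? ∣ i ∣

  ∣-minus : ∀ m i j → m ∣ i → m ∣ j → m ∣ (i ℤ.- j)
  ∣-minus m i j m∣i m∣j =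
    Signed.∣⇒∣ᵤ (Signed.∣m∣n⇒∣m-n {m} {i} {j} (Signed.∣ᵤ⇒∣ {m} {i} m∣i) (Signed.∣ᵤ⇒∣ {m} {j} m∣j))

  2*-<⇒pos : ∀ {p m} → (+ 2) ℤ.* (+ p) ℤ.< m → ∃ λ M → m ≡ + M × 2 ℕ.* p ℕ.< M
  2*-<⇒pos {p} {m} 2p<m with ≡.subst (ℤ._< m) (≡.sym (ℤ.pos-* 2 p)) 2p<m
  ... | ℤ.+<+ q = _ , refl , q

  -- By the triangle inequality |u - v| < m, and the only multiple of m that small is 0. The factor
  -- 2 in the hypothesis on m is spent here.
  small-congruent⇒≡ : ∀ m u v → (+ 2) ℤ.* (+ ∣ u ∣) ℤ.< m → (+ 2) ℤ.* (+ ∣ v ∣) ℤ.< m → m ∣ (u ℤ.- v) → u ≡ v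
  small-congruent⇒≡ m u v 2u<m 2v<m m∣u-v with 2*-<⇒pos {∣ u ∣} 2u<m
  ... | M , refl , 2u<M with 2*-<⇒pos {∣ v ∣} 2v<m
  ...   | _ , refl , 2v<M = ℤ.i-j≡0⇒i≡j u v (ℤ.∣i∣≡0⇒i≡0 (zero-of m∣u-v small))
    where
    small : ∣ u ℤ.- v ∣ ℕ.< M
    small = ℕ.≤-<-trans (ℤ.∣i-j∣≤∣i∣+∣j∣ u v) (ℕ.*-cancelˡ-< 2 _ _ (begin-strict
      2 ℕ.* (∣ u ∣ ℕ.+ ∣ v ∣)        ≡⟨ ℕ.*-distribˡ-+ 2 ∣ u ∣ ∣ v ∣ ⟩
      2 ℕ.* ∣ u ∣ ℕ.+ 2 ℕ.* ∣ v ∣    <⟨ ℕ.+-mono-< 2u<M 2v<M ⟩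
      M ℕ.+ M                        ≡⟨ ≡.cong (M ℕ.+_) (ℕ.+-identityʳ M) ⟨
      2 ℕ.* M                        ∎))
      where open ℕ.≤-Reasoning
    zero-of : ∀ {k} → M ℕ.∣ k → k ℕ.< M → k ≡ 0
    zero-of {zero}  _   _   = refl
    zero-of {suc k} M∣k k<M = ⊥-elim (ℕ.<⇒≱ k<M (ℕ.∣⇒≤ M∣k))

  -- Search for one pair satisfying the congruence. For any other such pair the b's cancel on
  -- subtraction, so the two differences are congruent and small, hence equal. If the search fails,
  -- any c will do.
  excludedDifference : ∀ m b b′ (X Y : List ℤ) → (∀ x y → x ∈ X → y ∈ Y → (+ 2) ℤ.* (+ ∣ x ℤ.- y ∣) ℤ.< m) →
    ∃ λ c → ∀ x y → x ∈ X → y ∈ Y → m ∣ ((x ℤ.+ b) ℤ.- (y ℤ.+ b′)) → x ℤ.- y ≡ c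
  excludedDifference m b b′ X Y small
    with Any.any? (λ x → Any.any? (λ y → m ∣? ((x ℤ.+ b) ℤ.- (y ℤ.+ b′))) Y) X
  ... | no none = + 0 , λ x y x∈ y∈ m∣ → ⊥-elim (none (lose x∈ (lose y∈ m∣)))
  ... | yes some with find some
  ...   | x₀ , x₀∈ , some′ with find some′
  ...     | y₀ , y₀∈ , m∣₀ = x₀ ℤ.- y₀ , λ x y x∈ y∈ m∣ →
    small-congruent⇒≡ m (x ℤ.- y) (x₀ ℤ.- y₀) (small x y x∈ y∈) (small x₀ y₀ x₀∈ y₀∈)
      (≡.subst (m ∣_) (regroup x y x₀ y₀) (∣-minus m ((x ℤ.+ b) ℤ.- (y ℤ.+ b′)) ((x₀ ℤ.+ b) ℤ.- (y₀ ℤ.+ b′)) m∣ m∣₀))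
    where
    open ℤ-Solver
    regroup : ∀ x y x₀ y₀ → ((x ℤ.+ b) ℤ.- (y ℤ.+ b′)) ℤ.- ((x₀ ℤ.+ b) ℤ.- (y₀ ℤ.+ b′)) ≡ (x ℤ.- y) ℤ.- (x₀ ℤ.- y₀)
    regroup x y x₀ y₀ = solve 6 (λ x y x₀ y₀ b b′ →
      ((x :+ b) :- (y :+ b′)) :- ((x₀ :+ b) :- (y₀ :+ b′)) := (x :- y) :- (x₀ :- y₀)) refl x y x₀ y₀ b b′

  -- A negative number times a positive one: in this range even the empty set would be large enough.
  k<n⇒[k-n]n<l : ∀ {k n} → k ℕ.< n → ∀ l → (+ k ℤ.- + n) ℤ.* (+ n) ℤ.< + l
  k<n⇒[k-n]n<l {k} {suc n} k<n l = ℤ.<-≤-trans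
    (ℤ.*-monoʳ-<-pos (+ suc n) (≡.subst (+ k ℤ.- + suc n ℤ.<_) (ℤ.+-inverseʳ (+ suc n)) (ℤ.+-monoˡ-< (ℤ.- (+ suc n)) (ℤ.+<+ k<n))))
    (ℤ.+≤+ z≤n)

  n≤k⇒[k-n]n<l : ∀ {k n l} → n ℕ.≤ k → (k ℕ.∸ n) ℕ.* n ℕ.< l → (+ k ℤ.- + n) ℤ.* (+ n) ℤ.< + l
  n≤k⇒[k-n]n<l {k} {n} {l} n≤k p = ≡.subst (ℤ._< + l)
    (≡.trans (ℤ.pos-* (k ℕ.∸ n) n) (≡.cong (ℤ._* + n) (≡.trans (≡.sym (ℤ.⊖-≥ n≤k)) (≡.sym (ℤ.m-n≡m⊖n k n)))))
    (ℤ.+<+ p)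

open Injections
open Integers

-- The integers inside an ordered field.

module Coefficient {c ℓ₁ ℓ₂ : Level} (F : OrderedField c ℓ₁ ℓ₂) where
  open OrderedField F hiding (zero) renaming (_<_ to infix 4 _<_)
  open IsStrictTotalOrder isStrictTotalOrder
    using (compare; _≟_; irrefl; asym; <-respʳ-≈; <-respˡ-≈) renaming (trans to <-trans)
  open import Algebra.Properties.Ring ring using (-‿distribˡ-*; -‿distribʳ-*)
  open import Algebra.Properties.AbelianGroup +-abelianGroup
    using () renaming (⁻¹-∙-comm to -‿+-comm; ε⁻¹≈ε to -0≈0; ⁻¹-involutive to -‿involutive;
                       x∙y⁻¹≈ε⇒x≈y to x-y≈0⇒x≈y; x≈y⇒x∙y⁻¹≈ε to x≈y⇒x-y≈0)
  open import Algebra.Properties.Semiring.Sum semiring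
    using (sum; sum-cong-≋; ∑-distrib-+; *-distribˡ-sum; sum-replicate-zero)
  open import Algebra.Properties.CommutativeMonoid.Sum *-commutativeMonoid
    using () renaming (sum to ∏; sum-remove to ∏-remove)
  import Relation.Binary.Reasoning.Setoid setoid as SR

  private
    1+x-1+y : ∀ x y → (1# + x) - (1# + y) ≈ x - y
    1+x-1+y x y = begin
      (1# + x) - (1# + y)         ≈⟨ +-cong (+-comm 1# x) (sym (-‿+-comm 1# y)) ⟩
      (x + 1#) + (- 1# + - y)     ≈⟨ +-assoc _ _ _ ⟩
      x + (1# + (- 1# + - y))     ≈⟨ +-congˡ (+-assoc _ _ _) ⟨
      x + ((1# + - 1#) + - y)     ≈⟨ +-congˡ (+-congʳ (-‿inverseʳ 1#)) ⟩
      x + (0# + - y)              ≈⟨ +-congˡ (+-identityˡ _) ⟩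
      x - y                       ∎
      where open SR

  fromℕ-+ : ∀ m n → fromℕ (m ℕ.+ n) ≈ fromℕ m + fromℕ n
  fromℕ-+ zero    n = sym (+-identityˡ _)
  fromℕ-+ (suc m) n = trans (+-congˡ (fromℕ-+ m n)) (sym (+-assoc _ _ _))

  fromℕ-* : ∀ m n → fromℕ (m ℕ.* n) ≈ fromℕ m * fromℕ n
  fromℕ-* zero    n = sym (zeroˡ _)
  fromℕ-* (suc m) n = begin
    fromℕ (n ℕ.+ m ℕ.* n)             ≈⟨ fromℕ-+ n _ ⟩
    fromℕ n + fromℕ (m ℕ.* n)         ≈⟨ +-cong (sym (*-identityˡ _)) (fromℕ-* m n) ⟩
    1# * fromℕ n + fromℕ m * fromℕ n  ≈⟨ distribʳ _ _ _ ⟨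
    (1# + fromℕ m) * fromℕ n          ∎
    where open SR

  fromℤ-⊖ : ∀ m n → fromℤ (m ℤ.⊖ n) ≈ fromℕ m - fromℕ n
  fromℤ-⊖ m       zero    = sym (trans (+-congˡ -0≈0) (+-identityʳ _))
  fromℤ-⊖ zero    (suc n) = sym (+-identityˡ _)
  fromℤ-⊖ (suc m) (suc n) = begin
    fromℤ (suc m ℤ.⊖ suc n)      ≡⟨ ≡.cong fromℤ (ℤ.[1+m]⊖[1+n]≡m⊖n m n) ⟩
    fromℤ (m ℤ.⊖ n)              ≈⟨ fromℤ-⊖ m n ⟩
    fromℕ m - fromℕ n            ≈⟨ 1+x-1+y _ _ ⟨
    fromℕ (suc m) - fromℕ (suc n) ∎
    where open SR

  fromℤ-neg : ∀ i → fromℤ (ℤ.- i) ≈ - fromℤ i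
  fromℤ-neg (+ zero)  = sym -0≈0
  fromℤ-neg (+ suc n) = refl
  fromℤ-neg -[1+ n ]  = sym (-‿involutive _)

  fromℤ-+ : ∀ i j → fromℤ (i ℤ.+ j) ≈ fromℤ i + fromℤ j
  fromℤ-+ (+ m)    (+ n)    = fromℕ-+ m n
  fromℤ-+ (+ m)    -[1+ n ] = fromℤ-⊖ m (suc n)
  fromℤ-+ -[1+ m ] (+ n)    = trans (fromℤ-⊖ n (suc m)) (+-comm _ _)
  fromℤ-+ -[1+ m ] -[1+ n ] = begin
    - fromℕ (suc (suc (m ℕ.+ n)))        ≡⟨ ≡.cong (λ k → - fromℕ (suc k)) (≡.sym (ℕ.+-suc m n)) ⟩
    - fromℕ (suc m ℕ.+ suc n)            ≈⟨ -‿cong (fromℕ-+ (suc m) (suc n)) ⟩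
    - (fromℕ (suc m) + fromℕ (suc n))    ≈⟨ -‿+-comm _ _ ⟨
    - fromℕ (suc m) + - fromℕ (suc n)    ∎
    where open SR

  fromℤ-minus : ∀ i j → fromℤ (i ℤ.- j) ≈ fromℤ i - fromℤ j
  fromℤ-minus i j = trans (fromℤ-+ i (ℤ.- j)) (+-congˡ (fromℤ-neg j))

  private
    fromℤ-*-+ : ∀ m j → fromℤ (+ m ℤ.* j) ≈ fromℕ m * fromℤ j
    fromℤ-*-+ m (+ n) = trans (reflexive (≡.cong fromℤ (≡.sym (ℤ.pos-* m n)))) (fromℕ-* m n)
    fromℤ-*-+ m -[1+ n ] = begin
      fromℤ (+ m ℤ.* -[1+ n ])       ≡⟨ ≡.cong fromℤ (ℤ.neg-distribʳ-* (+ m) (+ suc n)) ⟨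
      fromℤ (ℤ.- (+ m ℤ.* + suc n))  ≈⟨ fromℤ-neg (+ m ℤ.* + suc n) ⟩
      - fromℤ (+ m ℤ.* + suc n)      ≈⟨ -‿cong (fromℤ-*-+ m (+ suc n)) ⟩
      - (fromℕ m * fromℕ (suc n))    ≈⟨ -‿distribʳ-* _ _ ⟩
      fromℕ m * - fromℕ (suc n)      ∎
      where open SR

  fromℤ-* : ∀ i j → fromℤ (i ℤ.* j) ≈ fromℤ i * fromℤ j
  fromℤ-* (+ m)    j = fromℤ-*-+ m j
  fromℤ-* -[1+ m ] j = begin
    fromℤ (-[1+ m ] ℤ.* j)       ≡⟨ ≡.cong fromℤ (ℤ.neg-distribˡ-* (+ suc m) j) ⟨
    fromℤ (ℤ.- (+ suc m ℤ.* j))  ≈⟨ fromℤ-neg (+ suc m ℤ.* j) ⟩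
    - fromℤ (+ suc m ℤ.* j)      ≈⟨ -‿cong (fromℤ-*-+ (suc m) j) ⟩
    - (fromℕ (suc m) * fromℤ j)  ≈⟨ -‿distribˡ-* _ _ ⟩
    - fromℕ (suc m) * fromℤ j    ∎
    where open SR

  private
    -- Lets the ring solver normalise with coefficients in ℤ, where equality is decidable.
    ℤ⟶F : ℤ.+-*-rawRing -Raw-AlmostCommutative⟶ fromCommutativeRing commutativeRing
    ℤ⟶F = record
      { ⟦_⟧ = fromℤ ; +-homo = fromℤ-+ ; *-homo = fromℤ-* ; -‿homo = fromℤ-neg
      ; 0-homo = refl ; 1-homo = +-identityʳ 1# }

    fromℤ-weaklyDec : ∀ i j → Maybe (fromℤ i ≈ fromℤ j)
    fromℤ-weaklyDec i j with i ℤ.≟ j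
    ... | yes ≡.refl = just refl
    ... | no _       = nothing

  open import Algebra.Solver.Ring ℤ.+-*-rawRing (fromCommutativeRing commutativeRing) ℤ⟶F fromℤ-weaklyDec
    using (solve; _:=_; _:+_; _:*_; _:-_; :-_)

  -- Inverses, order and signs.

  0<⇒≉0 : ∀ {x} → 0# < x → ¬ x ≈ 0#
  0<⇒≉0 0<x x≈0 = irrefl (sym x≈0) 0<x

  -- Made total by the value 0 at 0, so that weights can be written without proofs that the nodes
  -- differ.
  inv : Carrier → Carrier
  inv x with x ≟ 0#
  ... | yes _  = 0#
  ... | no x≉0 = proj₁ (inverse x x≉0)

  *-inverse : ∀ {x} → ¬ x ≈ 0# → x * inv x ≈ 1#
  *-inverse {x} x≉0 with x ≟ 0#
  ... | yes x≈0 = ⊥-elim (x≉0 x≈0)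
  ... | no  x≉0 = proj₂ (inverse x x≉0)

  *-≉0 : ∀ {x y} → ¬ x ≈ 0# → ¬ y ≈ 0# → ¬ x * y ≈ 0#
  *-≉0 {x} {y} x≉0 y≉0 xy≈0 = y≉0 (begin
    y                ≈⟨ *-identityʳ y ⟨
    y * 1#           ≈⟨ *-congˡ (*-inverse x≉0) ⟨
    y * (x * inv x)  ≈⟨ solve 3 (λ x y z → y :* (x :* z) := (x :* y) :* z) refl x y (inv x) ⟩
    (x * y) * inv x  ≈⟨ *-congʳ xy≈0 ⟩
    0# * inv x       ≈⟨ zeroˡ _ ⟩
    0#               ∎)
    where open SR

  1≉0 : ¬ 1# ≈ 0#
  1≉0 = 0<⇒≉0 0<1

  inv-≉0 : ∀ {x} → ¬ x ≈ 0# → ¬ inv x ≈ 0#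
  inv-≉0 x≉0 ix≈0 = 1≉0 (trans (sym (*-inverse x≉0)) (trans (*-congˡ ix≈0) (zeroʳ _)))

  +-monoʳ-< : ∀ {x y} z → x < y → z + x < z + y
  +-monoʳ-< z x<y = <-respʳ-≈ (+-comm _ _) (<-respˡ-≈ (+-comm _ _) (+-monoˡ-< z x<y))

  x<y⇒0<y-x : ∀ {x y} → x < y → 0# < y - x
  x<y⇒0<y-x {x} x<y = <-respˡ-≈ (-‿inverseʳ x) (+-monoˡ-< (- x) x<y)

  0<y-x⇒x<y : ∀ {x y} → 0# < y - x → x < y
  0<y-x⇒x<y {x} {y} 0<y-x =
    <-respʳ-≈ (solve 2 (λ x y → (y :- x) :+ x := y) refl x y) (<-respˡ-≈ (+-identityˡ x) (+-monoˡ-< x 0<y-x))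

  +-pos : ∀ {x y} → 0# < x → 0# < y → 0# < x + y
  +-pos {x} {y} 0<x 0<y = <-trans 0<x (<-respˡ-≈ (+-identityʳ x) (+-monoʳ-< x 0<y))

  *-monoˡ-< : ∀ {x y z} → 0# < z → x < y → z * x < z * y
  *-monoˡ-< {x} {y} {z} 0<z x<y =
    0<y-x⇒x<y (<-respʳ-≈ (solve 3 (λ x y z → z :* (y :- x) := z :* y :- z :* x) refl x y z)
                         (*-pos 0<z (x<y⇒0<y-x x<y)))

  *-neg-neg : ∀ {x y} → x < 0# → y < 0# → 0# < x * y
  *-neg-neg {x} {y} x<0 y<0 =
    <-respʳ-≈ (trans (*-cong (+-identityˡ _) (+-identityˡ _)) (solve 2 (λ x y → (:- x) :* (:- y) := x :* y) refl x y))
              (*-pos (x<y⇒0<y-x x<0) (x<y⇒0<y-x y<0))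

  inv-pos : ∀ {x} → 0# < x → 0# < inv x
  inv-pos {x} 0<x with compare 0# (inv x)
  ... | tri< 0<i _ _ = 0<i
  ... | tri≈ _ 0≈i _ = ⊥-elim (1≉0 (trans (sym (*-inverse (0<⇒≉0 0<x))) (trans (*-congˡ (sym 0≈i)) (zeroʳ x))))
  ... | tri> _ _ i<0 = ⊥-elim (asym 0<1 (<-respʳ-≈ (zeroʳ x) (<-respˡ-≈ (*-inverse (0<⇒≉0 0<x)) (*-monoˡ-< 0<x i<0))))

  fromℕ-pos : ∀ n → 0# < fromℕ (suc n)
  fromℕ-pos zero    = <-respʳ-≈ (sym (+-identityʳ 1#)) 0<1
  fromℕ-pos (suc n) = +-pos 0<1 (fromℕ-pos n)

  fromℤ≈0⇒≡0 : ∀ i → fromℤ i ≈ 0# → i ≡ + 0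
  fromℤ≈0⇒≡0 (+ zero)  _ = ≡.refl
  fromℤ≈0⇒≡0 (+ suc n) p = ⊥-elim (0<⇒≉0 (fromℕ-pos n) p)
  fromℤ≈0⇒≡0 -[1+ n ]  p = ⊥-elim (0<⇒≉0 (fromℕ-pos n) (trans (sym (-‿involutive _)) (trans (-‿cong p) -0≈0)))

  fromℤ-injective : ∀ i j → fromℤ i ≈ fromℤ j → i ≡ j
  fromℤ-injective i j p =
    ℤ.i-j≡0⇒i≡j i j (fromℤ≈0⇒≡0 (i ℤ.- j) (trans (fromℤ-minus i j) (x≈y⇒x-y≈0 p)))

  fromℕ-injective : ∀ m n → fromℕ m ≈ fromℕ n → m ≡ n
  fromℕ-injective m n p = ℤ.+-injective (fromℤ-injective (+ m) (+ n) p)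

  -- Finite sums and divided differences in one variable.

  opaque
    Σ< : ℕ → (ℕ → Carrier) → Carrier
    Σ< k f = sum {k} (λ i → f (toℕ i))

    Σ<-zero : ∀ f → Σ< 0 f ≈ 0#
    Σ<-zero f = refl

    Σ<-suc : ∀ k f → Σ< (suc k) f ≈ f 0 + Σ< k (f ∘ suc)
    Σ<-suc k f = refl

    Σ<-cong : ∀ k {f g : ℕ → Carrier} → (∀ v → v ℕ.< k → f v ≈ g v) → Σ< k f ≈ Σ< k g
    Σ<-cong k p = sum-cong-≋ (λ i → p (toℕ i) (Fin.toℕ<n i))

    Σ<-+ : ∀ k (f g : ℕ → Carrier) → Σ< k (λ v → f v + g v) ≈ Σ< k f + Σ< k g
    Σ<-+ k f g = ∑-distrib-+ {k} _ _

    Σ<-* : ∀ k a (f : ℕ → Carrier) → Σ< k (λ v → a * f v) ≈ a * Σ< k f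
    Σ<-* k a f = sym (*-distribˡ-sum {k} a _)

    Σ<-0 : ∀ k {f : ℕ → Carrier} → (∀ v → v ℕ.< k → f v ≈ 0#) → Σ< k f ≈ 0#
    Σ<-0 k p = trans (Σ<-cong k p) (sum-replicate-zero k)

  -- (d , t) stands for the d + 1 nodes t 0, …, t d.
  Axis : Set c
  Axis = ℕ × (ℕ → Carrier)

  Distinct : Axis → Set ℓ₁
  Distinct (d , t) = ∀ u v → u ℕ.≤ d → v ℕ.≤ d → t u ≈ t v → u ≡ v

  Distinct-suc : ∀ {d t} → Distinct (suc d , t) → Distinct (d , t ∘ suc)
  Distinct-suc dist u v u≤d v≤d eq = ℕ.suc-injective (dist (suc u) (suc v) (s≤s u≤d) (s≤s v≤d) eq)

  -- The weights of the divided difference f[t₀,…,t_d] = Σ_v w_v f(t_v), by recursion on the nodes: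
  -- f[t₀,…,t_d] = h[t₁,…,t_d] with h(x) = (f(x) − f(t₀)) / (x − t₀).
  weight : ℕ → (ℕ → Carrier) → ℕ → Carrier
  weight zero    t _       = 1#
  weight (suc d) t zero    = - Σ< (suc d) (λ v → weight d (t ∘ suc) v * inv (t (suc v) - t 0))
  weight (suc d) t (suc v) = weight d (t ∘ suc) v * inv (t (suc v) - t 0)

  weight-cancel : ∀ d t → Distinct (suc d , t) → ∀ (g : Carrier → Carrier) v → v ℕ.< suc d →
    weight (suc d) t (suc v) * ((t (suc v) - t 0) * g (t (suc v))) ≈ weight d (t ∘ suc) v * g (t (suc v))
  weight-cancel d t dist g v v<d = begin
    (weight d (t ∘ suc) v * inv e) * (e * y)
      ≈⟨ solve 4 (λ w i e y → (w :* i) :* (e :* y) := (w :* y) :* (e :* i)) refl (weight d (t ∘ suc) v) (inv e) e y ⟩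
    (weight d (t ∘ suc) v * y) * (e * inv e)
      ≈⟨ *-congˡ (*-inverse e≉0) ⟩
    (weight d (t ∘ suc) v * y) * 1#
      ≈⟨ *-identityʳ _ ⟩
    weight d (t ∘ suc) v * y ∎
    where
    open SR
    e = t (suc v) - t 0
    y = g (t (suc v))
    e≉0 : ¬ e ≈ 0#
    e≉0 e≈0 with dist (suc v) 0 v<d z≤n (x-y≈0⇒x≈y _ _ e≈0)
    ... | ()

  opaque
    divDiff : Axis → (Carrier → Carrier) → Carrier
    divDiff (d , t) f = Σ< (suc d) (λ v → weight d t v * f (t v))

    divDiff-cong : ∀ X {f g} → (∀ x → f x ≈ g x) → divDiff X f ≈ divDiff X g
    divDiff-cong (d , t) p = Σ<-cong (suc d) (λ v _ → *-congˡ (p (t v)))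

    divDiff-+ : ∀ X f g → divDiff X (λ x → f x + g x) ≈ divDiff X f + divDiff X g
    divDiff-+ (d , t) f g = trans (Σ<-cong (suc d) (λ v _ → distribˡ _ _ _)) (Σ<-+ (suc d) _ _)

    divDiff-* : ∀ X a f → divDiff X (λ x → a * f x) ≈ a * divDiff X f
    divDiff-* (d , t) a f =
      trans (Σ<-cong (suc d) (λ v _ → solve 3 (λ w a y → w :* (a :* y) := a :* (w :* y)) refl (weight d t v) a (f (t v))))
            (Σ<-* (suc d) a (λ v → weight d t v * f (t v)))

    divDiff-0 : ∀ X → divDiff X (λ _ → 0#) ≈ 0#
    divDiff-0 (d , t) = Σ<-0 (suc d) (λ v _ → zeroʳ _)

    -- With at least two nodes the weights sum to zero: the one at `t 0` was defined as minus the
    -- sum of the others.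
    divDiff-const : ∀ d t a → divDiff (suc d , t) (λ _ → a) ≈ 0#
    divDiff-const d t a = begin
      _                                     ≈⟨ Σ<-suc (suc d) _ ⟩
      - W * a + Σ< (suc d) (λ v → w v * a)  ≈⟨ +-congˡ (Σ<-cong (suc d) (λ v _ → *-comm (w v) a)) ⟩
      - W * a + Σ< (suc d) (λ v → a * w v)  ≈⟨ +-congˡ (Σ<-* (suc d) a w) ⟩
      - W * a + a * W                       ≈⟨ +-cong (sym (-‿distribˡ-* W a)) (*-comm a W) ⟩
      - (W * a) + W * a                     ≈⟨ -‿inverseˡ _ ⟩
      0#                                    ∎
      where
      open SR
      w : ℕ → Carrier
      w v = weight d (t ∘ suc) v * inv (t (suc v) - t 0)
      W : Carrier
      W = Σ< (suc d) w

    -- For f(x) = (x - t₀) g(x) the quotient in the recursion is g itself: the term at t₀ vanishes,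
    -- and at the other nodes the factor cancels the inverse inside the weight.
    divDiff-shift : ∀ d t → Distinct (suc d , t) → ∀ g →
      divDiff (suc d , t) (λ x → (x - t 0) * g x) ≈ divDiff (d , t ∘ suc) g
    divDiff-shift d t dist g = begin
      _
        ≈⟨ Σ<-suc (suc d) _ ⟩
      weight (suc d) t 0 * ((t 0 - t 0) * g (t 0)) + Σ< (suc d) (λ v → weight (suc d) t (suc v) * ((t (suc v) - t 0) * g (t (suc v))))
        ≈⟨ +-cong (trans (*-congˡ (trans (*-congʳ (-‿inverseʳ _)) (zeroˡ _))) (zeroʳ _))
                  (Σ<-cong (suc d) (weight-cancel d t dist g)) ⟩
      0# + divDiff (d , t ∘ suc) g
        ≈⟨ +-identityˡ _ ⟩
      divDiff (d , t ∘ suc) g ∎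
      where open SR

    divDiff-Σ : ∀ d t f → divDiff (d , t) f ≈ Σ< (suc d) (λ v → weight d t v * f (t v))
    divDiff-Σ d t f = refl

    divDiff-single : ∀ t f → divDiff (0 , t) f ≈ f (t 0)
    divDiff-single t f = trans (Σ<-suc 0 _) (trans (+-congˡ (Σ<-zero _)) (trans (+-identityʳ _) (*-identityˡ _)))

    divDiff-vanish : ∀ d t {f} → (∀ v → v ℕ.≤ d → f (t v) ≈ 0#) → divDiff (d , t) f ≈ 0#
    divDiff-vanish d t p = Σ<-0 (suc d) (λ v v<1+d → trans (*-congˡ (p v (ℕ.≤-pred v<1+d))) (zeroʳ _))

  -- Iterated divided differences over a grid.

  -- Shared by degrees and axes so that the recursion for coefficients and the product rule for
  -- grids have one shape. Lowering an axis drops its first node; a single node cannot be lowered,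
  -- just as degree 0 cannot.
  record Lowering {x} (X : Set x) : Set x where
    field lower : X → Maybe X
  open Lowering {{...}} public

  instance
    lowerℕ : Lowering ℕ
    lowerℕ = record { lower = λ { zero → nothing ; (suc d) → just d } }

    lowerAxis : Lowering Axis
    lowerAxis = record { lower = λ { (zero , t) → nothing ; (suc d , t) → just (d , t ∘ suc) } }

  atLower : ∀ {x} {X : Set x} {{_ : Lowering X}} → (X → Carrier) → X → Carrier
  atLower G a = maybe G 0# (lower a)

  -- On degrees this is the rule for multiplying a polynomial p by ℓ·x: the coefficient of a
  -- monomial is the sum of ℓᵢ times the coefficient in p of that monomial divided by xᵢ, read as 0
  -- when xᵢ does not divide it.
  Σlower : ∀ {x} {X : Set x} {{_ : Lowering X}} {n} → (Vec X n → Carrier) → (Fin n → Carrier) → Vec X n → Carrier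
  Σlower G ℓ []      = 0#
  Σlower G ℓ (a ∷ A) = ℓ zero * atLower (λ a′ → G (a′ ∷ A)) a + Σlower (λ A′ → G (a ∷ A′)) (ℓ ∘ suc) A

  -- Write x = (x - t₀) + t₀: the first part drops the node t₀, the second is a scalar.
  divDiff-x* : ∀ X → Distinct X → ∀ g →
    divDiff X (λ x → x * g x) ≈ atLower (λ X′ → divDiff X′ g) X + proj₂ X 0 * divDiff X g
  divDiff-x* (zero , t) dist g =
    trans (divDiff-single t _) (sym (trans (+-identityˡ _) (*-congˡ (divDiff-single t g))))
  divDiff-x* (suc d , t) dist g = begin
    divDiff X (λ x → x * g x)
      ≈⟨ divDiff-cong X (λ x → solve 3 (λ x s y → x :* y := (x :- s) :* y :+ s :* y) refl x (t 0) (g x)) ⟩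
    divDiff X (λ x → (x - t 0) * g x + t 0 * g x)
      ≈⟨ divDiff-+ X _ _ ⟩
    divDiff X (λ x → (x - t 0) * g x) + divDiff X (λ x → t 0 * g x)
      ≈⟨ +-cong (divDiff-shift d t dist g) (divDiff-* X (t 0) g) ⟩
    divDiff (d , t ∘ suc) g + t 0 * divDiff X g ∎
    where
    open SR
    X : Axis
    X = suc d , t

  gridDiff : ∀ {n} → Vec Axis n → ((Fin n → Carrier) → Carrier) → Carrier
  gridDiff []      f = f ⟨⟩
  gridDiff (X ∷ A) f = divDiff X (λ x → gridDiff A (λ y → f (x ◂ y)))

  gridDiff-cong : ∀ {n} (A : Vec Axis n) {f g} → (∀ x → f x ≈ g x) → gridDiff A f ≈ gridDiff A g
  gridDiff-cong []      p = p _
  gridDiff-cong (X ∷ A) p = divDiff-cong X (λ x → gridDiff-cong A (λ y → p (x ◂ y)))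

  gridDiff-+ : ∀ {n} (A : Vec Axis n) f g → gridDiff A (λ x → f x + g x) ≈ gridDiff A f + gridDiff A g
  gridDiff-+ []      f g = refl
  gridDiff-+ (X ∷ A) f g = trans (divDiff-cong X (λ x → gridDiff-+ A _ _)) (divDiff-+ X _ _)

  gridDiff-* : ∀ {n} (A : Vec Axis n) a f → gridDiff A (λ x → a * f x) ≈ a * gridDiff A f
  gridDiff-* []      a f = refl
  gridDiff-* (X ∷ A) a f = trans (divDiff-cong X (λ x → gridDiff-* A a _)) (divDiff-* X a _)

  gridDiff-vanish : ∀ {n} (A : Vec Axis n) f →
    (∀ x → (∀ i → ∃ λ v → v ℕ.≤ proj₁ (Vec.lookup A i) × x i ≡ proj₂ (Vec.lookup A i) v) → f x ≈ 0#) →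
    gridDiff A f ≈ 0#
  gridDiff-vanish []            f p = p _ (λ ())
  gridDiff-vanish ((d , t) ∷ A) f p = divDiff-vanish d t (λ v v≤d →
    gridDiff-vanish A _ (λ y q → p (t v ◂ y) λ { zero → v , v≤d , ≡.refl ; (suc i) → q i }))

  divDiff-atLower : ∀ X {x} {Y : Set x} {{_ : Lowering Y}} (G : Carrier → Y → Carrier) a →
    divDiff X (λ x → atLower (G x) a) ≈ atLower (λ a′ → divDiff X (λ x → G x a′)) a
  divDiff-atLower X G a with lower a
  ... | nothing = divDiff-0 X
  ... | just _  = refl

  divDiff-Σlower : ∀ X {x} {Y : Set x} {{_ : Lowering Y}} {n} (G : Carrier → Vec Y n → Carrier) ℓ (A : Vec Y n) →
    divDiff X (λ x → Σlower (G x) ℓ A) ≈ Σlower (λ A′ → divDiff X (λ x → G x A′)) ℓ A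
  divDiff-Σlower X G ℓ []      = divDiff-0 X
  divDiff-Σlower X G ℓ (a ∷ A) =
    trans (divDiff-+ X _ _)
          (+-cong (trans (divDiff-* X (ℓ zero) _) (*-congˡ (divDiff-atLower X _ a)))
                  (divDiff-Σlower X (λ x A′ → G x (a ∷ A′)) (ℓ ∘ suc) A))

  dot : ∀ {n} → (Fin n → Carrier) → (Fin n → Carrier) → Carrier
  dot ℓ x = sum (λ i → ℓ i * x i)

  corner : ∀ {n} → Vec Axis n → Fin n → Carrier
  corner (X ∷ A) zero    = proj₂ X 0
  corner (X ∷ A) (suc i) = corner A i

  -- The product rule in n variables, by `divDiff-x*` on the first axis and induction on the others.
  -- The values of the first nodes are collected in the last term, which vanishes for degree reasons
  -- in `gridDiff-evalForms`.
  gridDiff-dot : ∀ {n} (A : Vec Axis n) → AllVec Distinct A → ∀ ℓ f →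
    gridDiff A (λ x → dot ℓ x * f x) ≈ Σlower (λ A′ → gridDiff A′ f) ℓ A + dot ℓ (corner A) * gridDiff A f
  gridDiff-dot []      _              ℓ f = sym (+-identityˡ _)
  gridDiff-dot (X ∷ A) (dist ∷ dists) ℓ f = begin
    divDiff X (λ x → gridDiff A (λ y → (ℓ zero * x + dot ℓ′ y) * f (x ◂ y)))
      ≈⟨ divDiff-cong X (λ x → trans (gridDiff-cong A (λ y →
           solve 4 (λ l x s y → (l :* x :+ s) :* y := (l :* x) :* y :+ s :* y) refl (ℓ zero) x (dot ℓ′ y) (f (x ◂ y))))
           (trans (gridDiff-+ A _ _) (+-cong (trans (gridDiff-* A (ℓ zero * x) _) (*-assoc _ _ _)) (gridDiff-dot A dists ℓ′ _)))) ⟩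
    divDiff X (λ x → ℓ zero * (x * g x) + (Σlower (λ A′ → gridDiff A′ (λ y → f (x ◂ y))) ℓ′ A + h * g x))
      ≈⟨ trans (divDiff-+ X _ _) (+-cong (divDiff-* X (ℓ zero) _) (trans (divDiff-+ X _ _)
           (+-cong (divDiff-Σlower X (λ x A′ → gridDiff A′ (λ y → f (x ◂ y))) ℓ′ A) (divDiff-* X h g)))) ⟩
    ℓ zero * divDiff X (λ x → x * g x) + (S + h * G)
      ≈⟨ +-congʳ (*-congˡ (divDiff-x* X dist g)) ⟩
    ℓ zero * (low + proj₂ X 0 * G) + (S + h * G)
      ≈⟨ solve 6 (λ l w t g s h → l :* (w :+ t :* g) :+ (s :+ h :* g) := (l :* w :+ s) :+ (l :* t :+ h) :* g) refl
           (ℓ zero) low (proj₂ X 0) G S h ⟩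
    (ℓ zero * low + S) + (ℓ zero * proj₂ X 0 + h) * G ∎
    where
    open SR
    ℓ′ = ℓ ∘ suc
    h = dot ℓ′ (corner A)
    g : Carrier → Carrier
    g x = gridDiff A (λ y → f (x ◂ y))
    G = divDiff X g
    S = Σlower (λ A′ → gridDiff (X ∷ A′) f) ℓ′ A
    low = atLower (λ X′ → divDiff X′ g) X

  -- Products of affine forms and their top coefficients.

  -- An affine form x ↦ ℓ·x − e is a pair (ℓ , e).
  Form : ℕ → Set c
  Form n = (Fin n → Carrier) × Carrier

  evalForm : ∀ {n} → Form n → (Fin n → Carrier) → Carrier
  evalForm (ℓ , e) x = dot ℓ x - e

  evalForms : ∀ {n} → List (Form n) → (Fin n → Carrier) → Carrier
  evalForms []      x = 1#
  evalForms (φ ∷ T) x = evalForm φ x * evalForms T x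

  -- The coefficient of ∏ xᵢ^(dᵢ) in ∏ (ℓ·x).
  coeff : ∀ {n} → List (Fin n → Carrier) → Vec ℕ n → Carrier
  coeff (ℓ ∷ T) ds           = Σlower (coeff T) ℓ ds
  coeff []      []           = 1#
  coeff []      (zero  ∷ ds) = coeff [] ds
  coeff []      (suc _ ∷ ds) = 0#

  Σlower-0 : ∀ {n} (G : Vec ℕ n → Carrier) ℓ ds →
    (∀ ds′ → suc (Vec.sum ds′) ≡ Vec.sum ds → G ds′ ≈ 0#) → Σlower G ℓ ds ≈ 0#
  Σlower-0 G ℓ []       p = refl
  Σlower-0 G ℓ (d ∷ ds) p = trans (+-cong (trans (*-congˡ (low d p)) (zeroʳ _))
    (Σlower-0 _ (ℓ ∘ suc) ds (λ ds′ eq → p (d ∷ ds′) (≡.trans (≡.sym (ℕ.+-suc d _)) (≡.cong (d ℕ.+_) eq))))) (+-identityʳ _)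
    where
    low : ∀ d → (∀ ds′ → suc (Vec.sum ds′) ≡ d ℕ.+ Vec.sum ds → G ds′ ≈ 0#) → atLower (λ d′ → G (d′ ∷ ds)) d ≈ 0#
    low zero    p = refl
    low (suc d) p = p (d ∷ ds) ≡.refl

  -- Each form uses up one unit of the total degree, so some exponent is still positive when the
  -- forms run out.
  coeff-deficient : ∀ {n} (T : List (Fin n → Carrier)) ds → length T ℕ.< Vec.sum ds → coeff T ds ≈ 0#
  coeff-deficient (ℓ ∷ T) ds           p =
    Σlower-0 (coeff T) ℓ ds (λ ds′ eq → coeff-deficient T ds′ (ℕ.≤-pred (≡.subst (suc (suc (length T)) ℕ.≤_) (≡.sym eq) p)))
  coeff-deficient []      (zero  ∷ ds) p = coeff-deficient [] ds p
  coeff-deficient []      (suc _ ∷ ds) p = refl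

  dims : ∀ {n} → Vec Axis n → Vec ℕ n
  dims = Vec.map proj₁

  Σlower-dims : ∀ {n} (G : Vec Axis n → Carrier) (H : Vec ℕ n → Carrier) ℓ A → AllVec Distinct A →
    (∀ A′ → AllVec Distinct A′ → suc (Vec.sum (dims A′)) ≡ Vec.sum (dims A) → G A′ ≈ H (dims A′)) →
    Σlower G ℓ A ≈ Σlower H ℓ (dims A)
  Σlower-dims G H ℓ []            _              p = refl
  Σlower-dims G H ℓ ((d , t) ∷ A) (dist ∷ dists) p = +-cong (*-congˡ (low d t dist p))
    (Σlower-dims _ _ (ℓ ∘ suc) A dists (λ A′ dists′ eq →
      p ((d , t) ∷ A′) (dist ∷ dists′) (≡.trans (≡.sym (ℕ.+-suc d _)) (≡.cong (d ℕ.+_) eq))))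
    where
    low : ∀ d t → Distinct (d , t) →
      (∀ A′ → AllVec Distinct A′ → suc (Vec.sum (dims A′)) ≡ d ℕ.+ Vec.sum (dims A) → G A′ ≈ H (dims A′)) →
      atLower (λ X → G (X ∷ A)) (d , t) ≈ atLower (λ d′ → H (d′ ∷ dims A)) d
    low zero    t dist p = refl
    low (suc d) t dist p = p ((d , t ∘ suc) ∷ A)
      (Distinct-suc dist ∷ dists) ≡.refl

  gridDiff-1 : ∀ {n} (A : Vec Axis n) → gridDiff A (λ _ → 1#) ≈ coeff [] (dims A)
  gridDiff-1 []                = refl
  gridDiff-1 ((zero  , t) ∷ A) = trans (divDiff-single t _) (gridDiff-1 A)
  gridDiff-1 ((suc d , t) ∷ A) = divDiff-const d t (gridDiff A (λ _ → 1#))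

  -- Splitting off one form leaves lowered grids, which match the recursion of `coeff`, and two
  -- scalar multiples of the remaining product on the unlowered grid. The latter has too few forms
  -- for that grid and gives 0, so neither nodes nor constants survive.
  gridDiff-evalForms : ∀ {n} (A : Vec Axis n) → AllVec Distinct A → ∀ T → length T ℕ.≤ Vec.sum (dims A) →
    gridDiff A (evalForms T) ≈ coeff (map proj₁ T) (dims A)
  gridDiff-evalForms A dists []            p = gridDiff-1 A
  gridDiff-evalForms A dists ((ℓ , e) ∷ T) p = begin
    gridDiff A (λ x → (dot ℓ x - e) * f x)
      ≈⟨ gridDiff-cong A (λ x → distribʳ (f x) (dot ℓ x) (- e)) ⟩
    gridDiff A (λ x → dot ℓ x * f x + - e * f x)
      ≈⟨ trans (gridDiff-+ A _ _) (+-cong (gridDiff-dot A dists ℓ f) (gridDiff-* A (- e) f)) ⟩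
    (Σlower (λ A′ → gridDiff A′ f) ℓ A + dot ℓ (corner A) * gridDiff A f) + - e * gridDiff A f
      ≈⟨ trans (+-cong (trans (+-congˡ (trans (*-congˡ G≈0) (zeroʳ _))) (+-identityʳ _)) (trans (*-congˡ G≈0) (zeroʳ _)))
               (+-identityʳ _) ⟩
    Σlower (λ A′ → gridDiff A′ f) ℓ A
      ≈⟨ Σlower-dims _ _ ℓ A dists (λ A′ dists′ eq → gridDiff-evalForms A′ dists′ T
           (ℕ.≤-pred (≡.subst (suc (length T) ℕ.≤_) (≡.sym eq) p))) ⟩
    Σlower (coeff (map proj₁ T)) ℓ (dims A) ∎
    where
    open SR
    f = evalForms T
    -- The induction hypothesis is used on the unlowered grid, which is why the lemma assumes `≤`
    -- and not equality of degrees.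
    G≈0 : gridDiff A f ≈ 0#
    G≈0 = trans (gridDiff-evalForms A dists T (ℕ.<⇒≤ p))
                (coeff-deficient (map proj₁ T) (dims A) (≡.subst (ℕ._< Vec.sum (dims A)) (≡.sym (length-map proj₁ T)) p))

  -- Sums over index assignments and their signs.

  Σgrid : ℕ → ∀ n → ((Fin n → ℕ) → Carrier) → Carrier
  Σgrid k zero    g = g (λ ())
  Σgrid k (suc n) g = Σ< k (λ v → Σgrid k n (λ a → g (v ◂ a)))

  ◂-< : ∀ {k n v} {a : Fin n → ℕ} → v ℕ.< k → (∀ i → a i ℕ.< k) → ∀ i → (v ◂ a) i ℕ.< k
  ◂-< v<k a<k zero    = v<k
  ◂-< v<k a<k (suc i) = a<k i

  Σgrid-cong : ∀ k n {g h} → (∀ a → (∀ i → a i ℕ.< k) → g a ≈ h a) → Σgrid k n g ≈ Σgrid k n h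
  Σgrid-cong k zero    p = p _ (λ ())
  Σgrid-cong k (suc n) p = Σ<-cong k (λ v v<k → Σgrid-cong k n (λ a a<k → p (v ◂ a) (◂-< v<k a<k)))

  Σgrid-* : ∀ k n b g → Σgrid k n (λ a → b * g a) ≈ b * Σgrid k n g
  Σgrid-* k zero    b g = refl
  Σgrid-* k (suc n) b g = trans (Σ<-cong k (λ v _ → Σgrid-* k n b _)) (Σ<-* k b _)

  Σgrid-0 : ∀ k n {g} → (∀ a → (∀ i → a i ℕ.< k) → g a ≈ 0#) → Σgrid k n g ≈ 0#
  Σgrid-0 k zero    p = p _ (λ ())
  Σgrid-0 k (suc n) p = Σ<-0 k (λ v v<k → Σgrid-0 k n (λ a a<k → p (v ◂ a) (◂-< v<k a<k)))

  Σ<-restrict : ∀ {m k} f → m ℕ.≤ k → (∀ v → m ℕ.≤ v → v ℕ.< k → f v ≈ 0#) → Σ< k f ≈ Σ< m f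
  Σ<-restrict f z≤n                     p = trans (Σ<-0 _ (λ v → p v z≤n)) (sym (Σ<-zero f))
  Σ<-restrict f (s≤s {m} {k} m≤k) p = trans (Σ<-suc k f) (trans
    (+-congˡ (Σ<-restrict (f ∘ suc) m≤k (λ v m≤v v<k → p (suc v) (s≤s m≤v) (s≤s v<k)))) (sym (Σ<-suc m f)))

  Σgrid-restrict : ∀ {m k} n g → m ℕ.≤ k → (∀ a → (∀ i → a i ℕ.< k) → (∃ λ i → m ℕ.≤ a i) → g a ≈ 0#) →
    Σgrid k n g ≈ Σgrid m n g
  Σgrid-restrict zero    g m≤k p = refl
  Σgrid-restrict {m} {k} (suc n) g m≤k p = trans
    (Σ<-restrict _ m≤k (λ v m≤v v<k → Σgrid-0 k n (λ a a<k → p (v ◂ a) (◂-< v<k a<k) (zero , m≤v))))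
    (Σ<-cong m (λ v v<m → Σgrid-restrict n _ m≤k (λ a a<k (i , m≤ai) →
      p (v ◂ a) (◂-< (ℕ.≤-trans v<m m≤k) a<k) (suc i , m≤ai))))

  NonNegative : Carrier → Set _
  NonNegative x = 0# < x ⊎ 0# ≈ x

  nonNeg+pos : ∀ {x y} → NonNegative x → 0# < y → 0# < x + y
  nonNeg+pos (inj₁ 0<x) 0<y = +-pos 0<x 0<y
  nonNeg+pos (inj₂ 0≈x) 0<y = <-respʳ-≈ (trans (sym (+-identityˡ _)) (+-congʳ 0≈x)) 0<y

  nonNeg+nonNeg : ∀ {x y} → NonNegative x → NonNegative y → NonNegative (x + y)
  nonNeg+nonNeg p          (inj₁ 0<y) = inj₁ (nonNeg+pos p 0<y)
  nonNeg+nonNeg (inj₁ 0<x) (inj₂ 0≈y) = inj₁ (<-respʳ-≈ (trans (sym (+-identityʳ _)) (+-congˡ 0≈y)) 0<x)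
  nonNeg+nonNeg (inj₂ 0≈x) (inj₂ 0≈y) = inj₂ (trans (sym (+-identityʳ _)) (+-cong 0≈x 0≈y))

  NonNegative-resp : ∀ {x y} → x ≈ y → NonNegative x → NonNegative y
  NonNegative-resp x≈y (inj₁ 0<x) = inj₁ (<-respʳ-≈ x≈y 0<x)
  NonNegative-resp x≈y (inj₂ 0≈x) = inj₂ (trans 0≈x x≈y)

  Σ<-nonNeg : ∀ k {f} → (∀ v → v ℕ.< k → NonNegative (f v)) → NonNegative (Σ< k f)
  Σ<-nonNeg zero    p = inj₂ (sym (Σ<-zero _))
  Σ<-nonNeg (suc k) p = NonNegative-resp (sym (Σ<-suc k _))
    (nonNeg+nonNeg (p 0 (s≤s z≤n)) (Σ<-nonNeg k (λ v v<k → p (suc v) (s≤s v<k))))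

  Σ<-pos : ∀ k {f} → (∀ v → v ℕ.< k → NonNegative (f v)) → ∀ {u} → u ℕ.< k → 0# < f u → 0# < Σ< k f
  Σ<-pos (suc k) p {zero} _ q = <-respʳ-≈ (trans (+-comm _ _) (sym (Σ<-suc k _)))
    (nonNeg+pos (Σ<-nonNeg k (λ v v<k → p (suc v) (s≤s v<k))) q)
  Σ<-pos (suc k) p {suc u} (s≤s u<k) q = <-respʳ-≈ (sym (Σ<-suc k _))
    (nonNeg+pos (p 0 (s≤s z≤n)) (Σ<-pos k (λ v v<k → p (suc v) (s≤s v<k)) u<k q))

  Σgrid-nonNeg : ∀ k n {g} → (∀ a → (∀ i → a i ℕ.< k) → NonNegative (g a)) → NonNegative (Σgrid k n g)
  Σgrid-nonNeg k zero    p = p _ (λ ())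
  Σgrid-nonNeg k (suc n) p = Σ<-nonNeg k (λ v v<k → Σgrid-nonNeg k n (λ a a<k → p (v ◂ a) (◂-< v<k a<k)))

  -- Positivity is asked at every function pointwise equal to `b`, since the sum assembles its own
  -- functions with `_◂_`.
  Σgrid-pos : ∀ k n {g} → (∀ a → (∀ i → a i ℕ.< k) → NonNegative (g a)) →
    ∀ (b : Fin n → ℕ) → (∀ i → b i ℕ.< k) → (∀ a → (∀ i → a i ≡ b i) → 0# < g a) → 0# < Σgrid k n g
  Σgrid-pos k zero    p b b<k q = q _ (λ ())
  Σgrid-pos k (suc n) p b b<k q = Σ<-pos k (λ v v<k → Σgrid-nonNeg k n (λ a a<k → p (v ◂ a) (◂-< v<k a<k))) (b<k zero)
    (Σgrid-pos k n (λ a a<k → p (b zero ◂ a) (◂-< (b<k zero) a<k)) (b ∘ suc) (b<k ∘ suc)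
      (λ a a≗b → q (b zero ◂ a) λ { zero → ≡.refl ; (suc i) → a≗b i }))

  -- Invariance of f under pointwise equality identifies `t v ◂ (t ∘ a)` with `t ∘ (v ◂ a)`.
  gridDiff-uniform : ∀ n d t f → (∀ x y → (∀ i → x i ≈ y i) → f x ≈ f y) →
    gridDiff (Vec.replicate n (d , t)) f ≈ Σgrid (suc d) n (λ a → ∏ (weight d t ∘ a) * f (t ∘ a))
  gridDiff-uniform zero    d t f f-cong = trans (f-cong _ _ (λ ())) (sym (*-identityˡ _))
  gridDiff-uniform (suc n) d t f f-cong = trans (divDiff-Σ d t _) (Σ<-cong (suc d) (λ v _ → begin
    weight d t v * gridDiff (Vec.replicate n (d , t)) (λ y → f (t v ◂ y))
      ≈⟨ *-congˡ (gridDiff-uniform n d t _ (λ x y x≈y → f-cong _ _ λ { zero → refl ; (suc i) → x≈y i })) ⟩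
    weight d t v * Σgrid (suc d) n (λ a → ∏ (weight d t ∘ a) * f (t v ◂ (t ∘ a)))
      ≈⟨ Σgrid-* (suc d) n (weight d t v) _ ⟨
    Σgrid (suc d) n (λ a → weight d t v * (∏ (weight d t ∘ a) * f (t v ◂ (t ∘ a))))
      ≈⟨ Σgrid-cong (suc d) n (λ a _ → trans (sym (*-assoc _ _ _))
           (*-congˡ (f-cong _ _ λ { zero → refl ; (suc i) → refl }))) ⟩
    Σgrid (suc d) n (λ a → ∏ (weight d t ∘ (v ◂ a)) * f (t ∘ (v ◂ a))) ∎))
    where open SR

  ∏< : ℕ → (ℕ → Carrier) → Carrier
  ∏< zero    w = 1#
  ∏< (suc k) w = w k * ∏< k w

  -- An injective assignment into {0,...,n-1} is a permutation; peeling off the largest value puts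
  -- the factors in a fixed order.
  ∏-injective : ∀ n (a : Fin n → ℕ) → Inj a → (∀ i → a i ℕ.< n) → ∀ w → ∏ (w ∘ a) ≈ ∏< n w
  ∏-injective zero    a inj a<n w = refl
  ∏-injective (suc n) a inj a<n w with injective⇒top a inj a<n
  ... | i , eq = trans (∏-remove {i = i} (w ∘ a)) (*-cong (reflexive (≡.cong w eq))
    (∏-injective n (removeAt a i) (removeAt-injective inj i) (removeAt-< inj a<n eq) w))

  ∏<-≉0 : ∀ k {w} → (∀ v → v ℕ.< k → ¬ w v ≈ 0#) → ¬ ∏< k w ≈ 0#
  ∏<-≉0 zero    p = 1≉0
  ∏<-≉0 (suc k) p = *-≉0 (p k ℕ.≤-refl) (∏<-≉0 k (λ v v<k → p v (ℕ.<-trans v<k ℕ.≤-refl)))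

  -- The system of forms encoding the theorem.

  evalForms-cong : ∀ {n} (T : List (Form n)) x y → (∀ i → x i ≈ y i) → evalForms T x ≈ evalForms T y
  evalForms-cong []            x y p = refl
  evalForms-cong ((ℓ , e) ∷ T) x y p = *-cong (+-congʳ (sum-cong-≋ (λ i → *-congˡ (p i)))) (evalForms-cong T x y p)

  evalForms-++ : ∀ {n} (T T′ : List (Form n)) x → evalForms (T ++ T′) x ≈ evalForms T x * evalForms T′ x
  evalForms-++ []      T′ x = sym (*-identityˡ _)
  evalForms-++ (φ ∷ T) T′ x = trans (*-congˡ (evalForms-++ T T′ x)) (sym (*-assoc _ _ _))

  evalForms-vanish : ∀ {n} {φ : Form n} {T} x → φ ∈ T → evalForm φ x ≈ 0# → evalForms T x ≈ 0#
  evalForms-vanish x (here ≡.refl) p = trans (*-congʳ p) (zeroˡ _)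
  evalForms-vanish x (there φ∈T)   p = trans (*-congˡ (evalForms-vanish x φ∈T p)) (zeroʳ _)

  shiftForms : ∀ {n} → List Carrier → List (Form n)
  shiftForms = map (λ s → (λ _ → 1#) , s)

  evalForm-shift : ∀ {n} s (x : Fin n → Carrier) → evalForm ((λ _ → 1#) , s) x ≈ sum x - s
  evalForm-shift s x = +-congʳ (sum-cong-≋ (λ i → *-identityˡ (x i)))

  coeff-univariate : ∀ d → coeff (replicate d (λ _ → 1#)) (d ∷ []) ≈ 1#
  coeff-univariate zero    = refl
  coeff-univariate (suc d) = trans (+-identityʳ _) (trans (*-identityˡ _) (coeff-univariate d))

  map-proj₁-shiftForms : ∀ {n} S → map proj₁ (shiftForms {n} S) ≡ replicate (length S) (λ _ → 1#)
  map-proj₁-shiftForms []      = ≡.refl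
  map-proj₁-shiftForms (s ∷ S) = ≡.cong ((λ _ → 1#) ∷_) (map-proj₁-shiftForms S)

  -- The divided difference of ∏_{u≥1} (x − t_u) is its leading coefficient 1, and only the node t₀ contributes.
  weight-≉0 : ∀ d t → Distinct (d , t) → ∀ v → v ℕ.≤ d → ¬ weight d t v ≈ 0#
  weight-≉0 zero    t dist v       v≤d       = 1≉0
  weight-≉0 (suc d) t dist (suc v) (s≤s v≤d) = *-≉0
    (weight-≉0 d (t ∘ suc) (Distinct-suc dist) v v≤d)
    (inv-≉0 (λ e≈0 → ℕ.1+n≢0 (dist (suc v) 0 (s≤s v≤d) z≤n (x-y≈0⇒x≈y _ _ e≈0))))
  weight-≉0 (suc d) t dist zero    _ w≈0 = 1≉0 (begin
    1#                                        ≈⟨ coeff-univariate (suc d) ⟨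
    coeff (replicate (suc d) (λ _ → 1#)) (suc d ∷ [])
      ≡⟨ ≡.cong (λ R → coeff R (suc d ∷ [])) (≡.trans (map-proj₁-shiftForms S) (≡.cong (λ l → replicate l (λ _ → 1#)) length-S)) ⟨
    coeff (map proj₁ (shiftForms S)) (suc d ∷ [])
      ≈⟨ gridDiff-evalForms ((suc d , t) ∷ []) (dist ∷ []) (shiftForms S)
           (ℕ.≤-reflexive (≡.trans (length-map _ S) (≡.trans length-S (≡.sym (ℕ.+-identityʳ _))))) ⟨
    divDiff (suc d , t) (λ x → evalForms (shiftForms S) (x ◂ ⟨⟩))
      ≈⟨ divDiff-Σ (suc d) t _ ⟩
    Σ< (suc (suc d)) (λ v → weight (suc d) t v * evalForms (shiftForms S) (t v ◂ ⟨⟩))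
      ≈⟨ Σ<-0 (suc (suc d)) term ⟩
    0#                                        ∎)
    where
    open SR
    S = map (t ∘ suc) (upTo (suc d))
    length-S : length S ≡ suc d
    length-S = ≡.trans (length-map (t ∘ suc) (upTo (suc d))) (length-upTo (suc d))
    term : ∀ v → v ℕ.< suc (suc d) → weight (suc d) t v * evalForms (shiftForms S) (t v ◂ ⟨⟩) ≈ 0#
    term zero    _         = trans (*-congʳ w≈0) (zeroˡ _)
    term (suc v) (s≤s v<d) = trans (*-congˡ (evalForms-vanish {1} (t (suc v) ◂ ⟨⟩) (∈-map⁺ _ (∈-map⁺ (t ∘ suc) (∈-upTo⁺ v<d)))
      (trans (evalForm-shift {1} (t (suc v)) (t (suc v) ◂ ⟨⟩)) (trans (+-congʳ (+-identityʳ _)) (-‿inverseʳ _))))) (zeroʳ _)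

  unit : ∀ {n} → Fin n → Carrier → Fin n → Carrier
  unit zero    p zero    = p
  unit zero    p (suc k) = 0#
  unit (suc i) p zero    = 0#
  unit (suc i) p (suc k) = unit i p k

  dot-unit : ∀ {n} (i : Fin n) p x → dot (unit i p) x ≈ p * x i
  dot-unit {suc n} zero    p x = trans (+-congˡ (trans (sum-cong-≋ {n} (λ k → zeroˡ (x (suc k)))) (sum-replicate-zero n))) (+-identityʳ _)
  dot-unit         (suc i) p x = trans (+-cong (zeroˡ _) (dot-unit i p (x ∘ suc))) (+-identityˡ _)

  -- One shape for both conditions: β = α with zero constants forbids αᵢaᵢ = αⱼaⱼ, while β = `ones`
  -- with the excluded differences as constants handles the congruences.
  pairForm : ∀ {n} → (Fin n → Carrier) → (Fin n → Fin n → Carrier) → Fin n × Fin n → Form n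
  pairForm β e (i , j) = (λ k → unit i (β i) k + unit j (- β j) k) , e i j

  evalForm-pair : ∀ {n} β e (i j : Fin n) x → evalForm (pairForm β e (i , j)) x ≈ (β i * x i - β j * x j) - e i j
  evalForm-pair {n} β e i j x = +-congʳ (begin
    sum (λ k → (unit i (β i) k + unit j (- β j) k) * x k)
      ≈⟨ sum-cong-≋ (λ k → distribʳ (x k) (unit i (β i) k) (unit j (- β j) k)) ⟩
    sum (λ k → unit i (β i) k * x k + unit j (- β j) k * x k)
      ≈⟨ ∑-distrib-+ (λ k → unit i (β i) k * x k) (λ k → unit j (- β j) k * x k) ⟩
    dot (unit i (β i)) x + dot (unit j (- β j)) x
      ≈⟨ +-cong (dot-unit i (β i) x) (dot-unit j (- β j) x) ⟩
    β i * x i + - β j * x j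
      ≈⟨ +-congˡ (-‿distribˡ-* (β j) (x j)) ⟨
    β i * x i - β j * x j ∎)
    where open SR

  pairForms : ∀ {n} → (Fin n → Carrier) → (Fin n → Fin n → Carrier) → List (Form n)
  pairForms {n} β e = map (pairForm β e) (pairs n)

  evalForms-pairs-vanish : ∀ {n} β e {i j : Fin n} x → i Fin.< j → β i * x i - β j * x j ≈ e i j → evalForms (pairForms β e) x ≈ 0#
  evalForms-pairs-vanish β e {i} {j} x i<j p =
    evalForms-vanish x (∈-map⁺ (pairForm β e) (∈-pairs i<j)) (trans (evalForm-pair β e i j x) (x≈y⇒x-y≈0 p))

  ones : ∀ {n} → Fin n → Carrier
  ones _ = 1#

  zeros : ∀ {n} → Fin n → Fin n → Carrier
  zeros _ _ = 0#

  system : ∀ {n} → (Fin n → Carrier) → (e e′ : Fin n → Fin n → Carrier) → List Carrier → List (Form n)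
  system α e e′ S = pairForms α e ++ (pairForms ones e′ ++ shiftForms S)

  -- What remains of `system` without constants; of the shifts only their number is kept.
  linearParts : ∀ {n} → (Fin n → Carrier) → ℕ → List (Fin n → Carrier)
  linearParts α N = map proj₁ (pairForms α zeros) ++ (map proj₁ (pairForms ones zeros) ++ replicate N ones)

  map-proj₁-pairForms : ∀ {n} (β : Fin n → Carrier) e → map proj₁ (pairForms β e) ≡ map proj₁ (pairForms β zeros)
  map-proj₁-pairForms {n} β e = ≡.trans (≡.sym (map-∘ (pairs n))) (map-∘ (pairs n))

  linearParts-system : ∀ {n} (α : Fin n → Carrier) e e′ S → map proj₁ (system α e e′ S) ≡ linearParts α (length S)
  linearParts-system α e e′ S = ≡.trans (map-++ proj₁ (pairForms α e) _)
    (≡.cong₂ _++_ (map-proj₁-pairForms α e)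
      (≡.trans (map-++ proj₁ (pairForms ones e′) _) (≡.cong₂ _++_ (map-proj₁-pairForms ones e′) (map-proj₁-shiftForms S))))

  length-system : ∀ {n} (α : Fin n → Carrier) e e′ S → length (system α e e′ S) ≡ triangle n ℕ.+ (triangle n ℕ.+ length S)
  length-system {n} α e e′ S = ≡.trans (length-++ (pairForms α e)) (≡.cong₂ ℕ._+_ (len α e)
    (≡.trans (length-++ (pairForms ones e′)) (≡.cong₂ ℕ._+_ (len ones e′) (length-map _ S))))
    where
    len : ∀ β e → length (pairForms {n} β e) ≡ triangle n
    len β e = ≡.trans (length-map (pairForm β e) (pairs n)) (length-pairs n)

  opaque
    -- The coefficient of ∏ xᵢᵈ in ∏_{i<j} (αᵢxᵢ − αⱼxⱼ)(xᵢ − xⱼ) · (x₁ + ⋯ + xₙ)^((d+1−n)n).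
    leadingCoeff : ∀ n → ℕ → (Fin n → Carrier) → Carrier
    leadingCoeff n d α = coeff (linearParts α ((suc d ℕ.∸ n) ℕ.* n)) (Vec.replicate n d)

    leadingCoeff-zero : ∀ d α → leadingCoeff 0 d α ≈ 1#
    leadingCoeff-zero d α = reflexive (≡.cong (λ N → coeff (replicate N (ones {0})) []) (ℕ.*-zeroʳ d))

    -- Nodes, `e`, `e′` and the entries of `S` are absent from the right side: this is what permits
    -- a change of grid and of constants.
    gridDiff-system : ∀ {n d} (A : Vec Axis n) → AllVec Distinct A → dims A ≡ Vec.replicate n d → n ℕ.≤ suc d →
      ∀ α e e′ S → length S ≡ (suc d ℕ.∸ n) ℕ.* n →
      gridDiff A (evalForms (system α e e′ S)) ≈ leadingCoeff n d α
    gridDiff-system {n} {d} A dists dimsA n≤1+d α e e′ S lenS = trans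
      (gridDiff-evalForms A dists (system α e e′ S) (ℕ.≤-reflexive (begin
        length (system α e e′ S)                         ≡⟨ length-system α e e′ S ⟩
        triangle n ℕ.+ (triangle n ℕ.+ length S)             ≡⟨ ≡.cong (λ l → triangle n ℕ.+ (triangle n ℕ.+ l)) lenS ⟩
        triangle n ℕ.+ (triangle n ℕ.+ (suc d ℕ.∸ n) ℕ.* n)    ≡⟨ degree-count n≤1+d ⟩
        n ℕ.* d                                            ≡⟨ sum-replicate n d ⟨
        Vec.sum (Vec.replicate n d)                      ≡⟨ ≡.cong Vec.sum dimsA ⟨
        Vec.sum (dims A)                                 ∎)))
      (reflexive (≡.cong₂ coeff (≡.trans (linearParts-system α e e′ S) (≡.cong (linearParts α) lenS)) dimsA))
      where open ≡.≡-Reasoning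

  AllVec-replicate : ∀ n {X} → Distinct X → AllVec Distinct (Vec.replicate n X)
  AllVec-replicate zero    p = []
  AllVec-replicate (suc n) p = p ∷ AllVec-replicate n p

  evalForms-system : ∀ {n} (α : Fin n → Carrier) e e′ S x →
    evalForms (system α e e′ S) x ≈ (evalForms (pairForms α e) x * evalForms (pairForms ones e′) x) * evalForms (shiftForms S) x
  evalForms-system α e e′ S x = trans (evalForms-++ (pairForms α e) _ x)
    (trans (*-congˡ (evalForms-++ (pairForms ones e′) _ x)) (sym (*-assoc _ _ _)))

  -- The two pair products and their sign on geometric nodes.

  opaque
    twoVandermonde : ∀ {n} → (Fin n → Carrier) → (Fin n → Carrier) → Carrier
    twoVandermonde α x = evalForms (pairForms α zeros) x * evalForms (pairForms ones zeros) x

    collision⇒0 : ∀ {n} (α : Fin n → Carrier) {i j} x → i Fin.< j → x i ≈ x j → twoVandermonde α x ≈ 0#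
    collision⇒0 α x i<j p = trans (*-congˡ (evalForms-pairs-vanish ones zeros x i<j
      (x≈y⇒x-y≈0 (trans (*-identityˡ _) (trans p (sym (*-identityˡ _))))))) (zeroʳ _)

    -- The two products are regrouped pair by pair, so only the product of two matching factors
    -- needs a sign.
    twoVandermonde-pos : ∀ {n} (α : Fin n → Carrier) x →
      (∀ i j → i Fin.< j → 0# < (α i * x i - α j * x j) * (x i - x j)) → 0# < twoVandermonde α x
    twoVandermonde-pos {n} α x p = positive (pairs n) (λ {i} {j} ij∈ → p i j (∈-pairs⁻ ij∈))
      where
      positive : ∀ ps → (∀ {i j} → (i , j) ∈ ps → 0# < (α i * x i - α j * x j) * (x i - x j)) →
        0# < evalForms (map (pairForm α zeros) ps) x * evalForms (map (pairForm ones zeros) ps) x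
      positive []             q = <-respʳ-≈ (sym (*-identityˡ _)) 0<1
      positive ((i , j) ∷ ps) q = <-respʳ-≈
        (trans (*-congʳ (*-cong (sym (trans (evalForm-pair α zeros i j x) (minus-0 _)))
                                (sym (trans (evalForm-pair ones zeros i j x) (trans (minus-0 _)
                                  (+-cong (*-identityˡ _) (-‿cong (*-identityˡ _))))))))
               (solve 4 (λ a b u v → (a :* b) :* (u :* v) := (a :* u) :* (b :* v)) refl
                 (evalForm (pairForm α zeros (i , j)) x) (evalForm (pairForm ones zeros (i , j)) x) _ _))
        (*-pos (q (here ≡.refl)) (positive ps (λ ij∈ → q (there ij∈))))
        where
        minus-0 : ∀ y → y - 0# ≈ y
        minus-0 y = trans (+-congˡ -0≈0) (+-identityʳ y)

    evalForms-system-zeros : ∀ {n} (α : Fin n → Carrier) S x →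
      evalForms (system α zeros zeros S) x ≈ twoVandermonde α x * evalForms (shiftForms S) x
    evalForms-system-zeros α S x = evalForms-system α zeros zeros S x

  upperBound : ∀ {n} (x : Fin n → Carrier) → ∃ λ B → 1# < B × ∀ i → x i < B
  upperBound {zero} x = 1# + 1# , <-respˡ-≈ (+-identityʳ 1#) (+-monoʳ-< 1# 0<1) , λ ()
  upperBound {suc n} x with upperBound (x ∘ suc)
  ... | B , 1<B , x<B with compare (x zero) B
  ...   | tri< x₀<B _ _ = B , 1<B , λ { zero → x₀<B ; (suc i) → x<B i }
  ...   | tri≈ _ x₀≈B _ = B + 1# , <-trans 1<B B<B+1 , λ { zero → <-respˡ-≈ (sym x₀≈B) B<B+1 ; (suc i) → <-trans (x<B i) B<B+1 }
    where
    B<B+1 : B < B + 1#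
    B<B+1 = <-respˡ-≈ (+-identityʳ B) (+-monoʳ-< B 0<1)
  ...   | tri> _ _ B<x₀ = x zero + 1# , <-trans 1<B (<-trans B<x₀ x<x+1) ,
                          λ { zero → x<x+1 ; (suc i) → <-trans (x<B i) (<-trans B<x₀ x<x+1) }
    where
    x<x+1 : x zero < x zero + 1#
    x<x+1 = <-respˡ-≈ (+-identityʳ (x zero)) (+-monoʳ-< (x zero) 0<1)

  -- M = I·B with B above all αⱼ and I above all 1/αᵢ: then αᵢ·I > 1, so αᵢ·M > B > αⱼ.
  ratioBound : ∀ {n} (α : Fin n → Carrier) → (∀ i → 0# < α i) → ∃ λ M → 1# < M × ∀ i j → α j < α i * M
  ratioBound α α-pos with upperBound α | upperBound (inv ∘ α)
  ... | B , 1<B , α<B | I , 1<I , i<I = I * B , 1<IB , bound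
    where
    0<B : 0# < B
    0<B = <-trans 0<1 1<B
    1<IB : 1# < I * B
    1<IB = <-trans 1<I (<-respˡ-≈ (*-identityʳ I) (*-monoˡ-< (<-trans 0<1 1<I) 1<B))
    bound : ∀ i j → α j < α i * (I * B)
    bound i j = <-trans (α<B j) (<-respˡ-≈ (trans (*-congˡ (*-inverse (0<⇒≉0 (α-pos i)))) (*-identityʳ B))
      (<-respʳ-≈ (solve 3 (λ a i b → b :* (a :* i) := a :* (i :* b)) refl (α i) I B)
        (*-monoˡ-< 0<B (*-monoˡ-< (α-pos i) (i<I i)))))

  power : Carrier → ℕ → Carrier
  power M zero    = 1#
  power M (suc v) = M * power M v

  module _ {M : Carrier} (1<M : 1# < M) where
    power-pos : ∀ v → 0# < power M v
    power-pos zero    = 0<1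
    power-pos (suc v) = *-pos (<-trans 0<1 1<M) (power-pos v)

    -- The assumption settles neighbouring exponents; a larger gap only increases the right side, as
    -- M > 1.
    power-dominates : ∀ {p q} → 0# < q → p < q * M → ∀ {v u} → v ℕ.< u → p * power M v < q * power M u
    power-dominates {p} {q} 0<q p<qM {v} {suc u} (s≤s v≤u) with ℕ.m≤n⇒m<n∨m≡n v≤u
    ... | inj₂ ≡.refl = <-respˡ-≈ (*-comm _ _) (<-respʳ-≈ (solve 3 (λ q m t → t :* (q :* m) := q :* (m :* t)) refl q M (power M u))
                          (*-monoˡ-< (power-pos u) p<qM))
    ... | inj₁ v<u    = <-trans (power-dominates 0<q p<qM v<u)
                          (*-monoˡ-< 0<q (<-respʳ-≈ (*-comm _ _) (<-respˡ-≈ (*-identityʳ _) (*-monoˡ-< (power-pos u) 1<M))))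

    power-mono : ∀ {v u} → v ℕ.< u → power M v < power M u
    power-mono v<u = <-respˡ-≈ (*-identityˡ _) (<-respʳ-≈ (*-identityˡ _)
      (power-dominates 0<1 (<-respʳ-≈ (sym (*-identityˡ M)) 1<M) v<u))

    power-injective : ∀ u v → power M u ≈ power M v → u ≡ v
    power-injective u v eq with ℕ.<-cmp u v
    ... | tri< u<v _ _ = ⊥-elim (irrefl eq (power-mono u<v))
    ... | tri≈ _ u≡v _ = u≡v
    ... | tri> _ _ v<u = ⊥-elim (irrefl (sym eq) (power-mono v<u))

  x<y⇒x-y<0 : ∀ {x y} → x < y → x - y < 0#
  x<y⇒x-y<0 {x} {y} x<y = <-respʳ-≈ (-‿inverseʳ y) (+-monoˡ-< (- y) x<y)

  -- For each pair both factors are negative if aᵢ < aⱼ and both positive if aᵢ > aⱼ; equality is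
  -- excluded by injectivity.
  geometric-pos : ∀ {n} (α : Fin n → Carrier) → (∀ i → 0# < α i) → ∀ {M} → 1# < M → (∀ i j → α j < α i * M) →
    ∀ (a : Fin n → ℕ) → Inj a → 0# < twoVandermonde α (power M ∘ a)
  geometric-pos α α-pos {M} 1<M bound a inj = twoVandermonde-pos α (power M ∘ a) factor
    where
    factor : ∀ i j → i Fin.< j → 0# < (α i * power M (a i) - α j * power M (a j)) * (power M (a i) - power M (a j))
    factor i j i<j with ℕ.<-cmp (a i) (a j)
    ... | tri< ai<aj _ _ = *-neg-neg (x<y⇒x-y<0 (power-dominates 1<M (α-pos j) (bound j i) ai<aj))
                                     (x<y⇒x-y<0 (power-mono 1<M ai<aj))
    ... | tri≈ _ ai≡aj _ = ⊥-elim (Fin.<⇒≢ i<j (inj ai≡aj))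
    ... | tri> _ _ aj<ai = *-pos (x<y⇒0<y-x (power-dominates 1<M (α-pos i) (bound i j) aj<ai))
                                 (x<y⇒0<y-x (power-mono 1<M aj<ai))

  evalForms-system-[] : ∀ {n} (α : Fin n → Carrier) x → evalForms (system α zeros zeros []) x ≈ twoVandermonde α x
  evalForms-system-[] α x = trans (evalForms-system-zeros α [] x) (*-identityʳ _)

  gridDiff-uniform-system : ∀ {n d t} → Distinct (d , t) → n ℕ.≤ suc d → ∀ α e e′ S → length S ≡ (suc d ℕ.∸ n) ℕ.* n →
    leadingCoeff n d α ≈ Σgrid (suc d) n (λ a → ∏ (weight d t ∘ a) * evalForms (system α e e′ S) (t ∘ a))
  gridDiff-uniform-system {n} {d} {t} dist n≤1+d α e e′ S lenS = trans
    (sym (gridDiff-system (Vec.replicate n (d , t)) (AllVec-replicate n dist) (map-replicate proj₁ (d , t) n) n≤1+d α e e′ S lenS))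
    (gridDiff-uniform n d t _ (evalForms-cong (system α e e′ S)))

  -- On the grid {t₀,…,t_d}^(d+1) only the bijective assignments survive, and they all carry the same weight.
  leadingCoeff-square : ∀ d t → Distinct (d , t) → ∀ α →
    leadingCoeff (suc d) d α ≈ ∏< (suc d) (weight d t) * Σgrid (suc d) (suc d) (λ a → twoVandermonde α (t ∘ a))
  leadingCoeff-square d t dist α = trans
    (gridDiff-uniform-system dist ℕ.≤-refl α zeros zeros [] (≡.sym (≡.cong (ℕ._* suc d) (ℕ.n∸n≡0 d))))
    (trans (Σgrid-cong (suc d) (suc d) term) (Σgrid-* (suc d) (suc d) (∏< (suc d) (weight d t)) (λ a → twoVandermonde α (t ∘ a))))
    where
    term : ∀ a → (∀ i → a i ℕ.< suc d) → ∏ (weight d t ∘ a) * evalForms (system α zeros zeros []) (t ∘ a) ≈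
      ∏< (suc d) (weight d t) * twoVandermonde α (t ∘ a)
    term a a<n with injective⊎collision a
    ... | inj₁ inj = *-cong (∏-injective (suc d) a inj a<n (weight d t)) (evalForms-system-[] α (t ∘ a))
    ... | inj₂ (i , j , i<j , eq) = trans (*-congˡ (trans (evalForms-system-[] α (t ∘ a)) V≈0))
                                     (trans (zeroʳ _) (sym (trans (*-congˡ V≈0) (zeroʳ _))))
      where V≈0 = collision⇒0 α (t ∘ a) i<j (reflexive (≡.cong t eq))

  ∏-weight-≉0 : ∀ k d t → k ℕ.≤ suc d → Distinct (d , t) → ¬ ∏< k (weight d t) ≈ 0#
  ∏-weight-≉0 k d t k≤1+d dist = ∏<-≉0 k {weight d t} (λ v v<k → weight-≉0 d t dist v (ℕ.≤-pred (ℕ.≤-trans v<k k≤1+d)))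

  leadingCoeff-square-nodes-≉0 : ∀ d t → Distinct (d , t) → ∀ α →
    (∀ a → (∀ i → a i ℕ.< suc d) → Inj a → 0# < twoVandermonde α (t ∘ a)) → ¬ leadingCoeff (suc d) d α ≈ 0#
  leadingCoeff-square-nodes-≉0 d t dist α pos c≈0 =
    *-≉0 (∏-weight-≉0 (suc d) d t ℕ.≤-refl dist) (0<⇒≉0 positive) (trans (sym (leadingCoeff-square d t dist α)) c≈0)
    where
    nonNeg : ∀ a → (∀ i → a i ℕ.< suc d) → NonNegative (twoVandermonde α (t ∘ a))
    nonNeg a a<n with injective⊎collision a
    ... | inj₁ inj = inj₁ (pos a a<n inj)
    ... | inj₂ (i , j , i<j , eq) = inj₂ (sym (collision⇒0 α (t ∘ a) i<j (reflexive (≡.cong t eq))))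
    positive : 0# < Σgrid (suc d) (suc d) (λ a → twoVandermonde α (t ∘ a))
    -- The identity arrangement supplies the strictly positive term; every other term is
    -- nonnegative.
    positive = Σgrid-pos (suc d) (suc d) nonNeg toℕ Fin.toℕ<n (λ a a≗toℕ →
      pos a (λ i → ≡.subst (ℕ._< suc d) (≡.sym (a≗toℕ i)) (Fin.toℕ<n i)) (λ {i} {j} eq →
        Fin.toℕ-injective (≡.trans (≡.sym (a≗toℕ i)) (≡.trans eq (a≗toℕ j)))))

  -- Over the nodes Mᵛ with M large, αᵢtᵤ − αⱼtᵥ has the sign of tᵤ − tᵥ, so no cancellation occurs.
  leadingCoeff-square-≉0 : ∀ d α → (∀ i → 0# < α i) → ¬ leadingCoeff (suc d) d α ≈ 0#
  leadingCoeff-square-≉0 d α α-pos =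
    let M , 1<M , bound = ratioBound α α-pos in
    leadingCoeff-square-nodes-≉0 d (power M) (λ u v _ _ → power-injective 1<M u v) α
      (λ a _ inj → geometric-pos α α-pos 1<M bound a inj)

  -- Non-vanishing of the coefficient for general d, on the nodes 0, ..., d.

  sum-fromℕ : ∀ {n} (a : Fin n → ℕ) → sum (fromℕ ∘ a) ≈ fromℕ (sumℕ a)
  sum-fromℕ {zero}  a = refl
  sum-fromℕ {suc n} a = trans (+-congˡ (sum-fromℕ (a ∘ suc))) (sym (fromℕ-+ (a zero) _))

  evalForms-shift-cong : ∀ {n} S (x y : Fin n → Carrier) → sum x ≈ sum y → evalForms (shiftForms S) x ≈ evalForms (shiftForms S) y
  evalForms-shift-cong []      x y p = refl
  evalForms-shift-cong (s ∷ S) x y p = *-cong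
    (trans (evalForm-shift s x) (trans (+-congʳ p) (sym (evalForm-shift s y)))) (evalForms-shift-cong S x y p)

  evalForms-shift-≉0 : ∀ {n} S (x : Fin n → Carrier) → (∀ {s} → s ∈ S → ¬ sum x ≈ s) → ¬ evalForms (shiftForms S) x ≈ 0#
  evalForms-shift-≉0 []      x p = 1≉0
  evalForms-shift-≉0 (s ∷ S) x p = *-≉0
    (λ e≈0 → p (here ≡.refl) (x-y≈0⇒x≈y _ _ (trans (sym (evalForm-shift s x)) e≈0)))
    (evalForms-shift-≉0 S x (λ s∈S → p (there s∈S)))

  evalForms-shift-vanish : ∀ {n} {S s} (x : Fin n → Carrier) → s ∈ S → sum x ≈ s → evalForms (shiftForms S) x ≈ 0#
  evalForms-shift-vanish {s = s} x s∈S p =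
    evalForms-vanish x (∈-map⁺ _ s∈S) (trans (evalForm-shift s x) (x≈y⇒x-y≈0 p))

  sumℕ-toℕ : ∀ n → sumℕ {n} toℕ ≡ triangle n
  sumℕ-toℕ n = ℕ.≤-antisym (ℕ.≤-trans (sum≤triangle n toℕ Fin.toℕ-injective Fin.toℕ<n) (ℕ.≤-reflexive
    (≡.trans (≡.cong (λ r → triangle n ℕ.+ r ℕ.* n) (ℕ.n∸n≡0 n)) (ℕ.+-identityʳ _))))
    (triangle≤sum n toℕ Fin.toℕ-injective Fin.toℕ<n)

  -- The terms may have either sign, so this is not read off directly: the sum is a factor of the
  -- square coefficient, already known to be nonzero from the geometric nodes.
  Σgrid-fromℕ-≉0 : ∀ m → 0 ℕ.< m → ∀ α → (∀ i → 0# < α i) → ¬ Σgrid m m (λ a → twoVandermonde α (fromℕ ∘ a)) ≈ 0#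
  Σgrid-fromℕ-≉0 (suc d) _ α α-pos V≈0 = leadingCoeff-square-≉0 d α α-pos
    (trans (leadingCoeff-square d fromℕ (λ u v _ _ → fromℕ-injective u v) α) (trans (*-congˡ V≈0) (zeroʳ _)))

  -- Over the nodes 0,…,d, the shifts kill every sum of distinct nodes except the least one, 0+1+⋯+(n−1).
  leadingCoeff-≉0 : ∀ m d → m ℕ.≤ suc d → ∀ α → (∀ i → 0# < α i) → ¬ leadingCoeff m d α ≈ 0#
  leadingCoeff-≉0 zero d _ α _ c≈0 = 1≉0 (trans (sym (leadingCoeff-zero d α)) c≈0)
  leadingCoeff-≉0 m@(suc _) d m≤1+d α α-pos c≈0 = *-≉0 (*-≉0 (∏-weight-≉0 m d fromℕ m≤1+d (dist d)) Z≉0) (Σgrid-fromℕ-≉0 m (s≤s z≤n) α α-pos) (trans (sym value) c≈0)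
    where
    N : ℕ
    N = (suc d ℕ.∸ m) ℕ.* m
    S : List Carrier
    -- These are all values above the least that a sum of m distinct nodes can take: `triangle m` +
    -- 1 up to `triangle m` + N.
    S = map (λ s → fromℕ (triangle m ℕ.+ suc s)) (upTo N)
    W : Carrier
    W = ∏< m (weight d fromℕ)
    Z : Carrier
    Z = evalForms (shiftForms S) (fromℕ ∘ toℕ {m})
    V : Carrier
    V = Σgrid m m (λ a → twoVandermonde α (fromℕ ∘ a))
    dist : ∀ d → Distinct (d , fromℕ)
    dist d u v _ _ = fromℕ-injective u v
    sum-toℕ : sum (fromℕ ∘ toℕ {m}) ≈ fromℕ (triangle m)
    sum-toℕ = trans (sum-fromℕ (toℕ {m})) (reflexive (≡.cong fromℕ (sumℕ-toℕ m)))
    Z≉0 : ¬ Z ≈ 0#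
    Z≉0 = evalForms-shift-≉0 S (fromℕ ∘ toℕ) avoid
      where
      avoid : ∀ {s} → s ∈ S → ¬ sum (fromℕ ∘ toℕ {m}) ≈ s
      avoid s∈S eq with ∈-map⁻ (λ s → fromℕ (triangle m ℕ.+ suc s)) s∈S
      ... | s , _ , ≡.refl = ℕ.m≢1+m+n (triangle m)
        (≡.trans (fromℕ-injective (triangle m) _ (trans (sym sum-toℕ) eq)) (ℕ.+-suc (triangle m) s))
    g : (Fin m → ℕ) → Carrier
    g a = ∏ (weight d fromℕ ∘ a) * evalForms (system α zeros zeros S) (fromℕ ∘ a)
    V≈0⇒g≈0 : ∀ a → twoVandermonde α (fromℕ ∘ a) ≈ 0# → g a ≈ 0#
    V≈0⇒g≈0 a p = trans (*-congˡ (trans (evalForms-system-zeros α S _) (trans (*-congʳ p) (zeroˡ _)))) (zeroʳ _)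
    outside : ∀ a → (∀ i → a i ℕ.< suc d) → (∃ λ i → m ℕ.≤ a i) → g a ≈ 0#
    outside a a<1+d (i , m≤ai) with injective⊎collision a
    ... | inj₂ (i , j , i<j , eq) = V≈0⇒g≈0 a (collision⇒0 α (fromℕ ∘ a) i<j (reflexive (≡.cong fromℕ eq)))
    ... | inj₁ inj = trans (*-congˡ (trans (evalForms-system-zeros α S _) (trans (*-congˡ
            (evalForms-shift-vanish (fromℕ ∘ a) (∈-map⁺ _ (∈-upTo⁺ s<N)) (trans (sum-fromℕ a) (reflexive (≡.cong fromℕ sum≡)))))
            (zeroʳ _)))) (zeroʳ _)
      where
      t<sum : triangle m ℕ.< sumℕ a
      t<sum = ℕ.≤∧≢⇒< (triangle≤sum (suc d) a inj a<1+d)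
        (λ eq → ℕ.<⇒≱ (sum≡triangle⇒< (suc d) a inj a<1+d (≡.sym eq) i) m≤ai)
      s = sumℕ a ℕ.∸ suc (triangle m)
      sum≡ : sumℕ a ≡ triangle m ℕ.+ suc s
      sum≡ = ≡.sym (≡.trans (ℕ.+-suc (triangle m) s) (ℕ.m+[n∸m]≡n t<sum))
      s<N : s ℕ.< N
      s<N = ℕ.+-cancelˡ-≤ (triangle m) (suc s) N (≡.subst (ℕ._≤ triangle m ℕ.+ N) sum≡ (sum≤triangle (suc d) a inj a<1+d))
    -- Below m every injective assignment has the same sum, so the shifts contribute the constant
    -- `Z`.
    inside : ∀ a → (∀ i → a i ℕ.< m) → g a ≈ (W * Z) * twoVandermonde α (fromℕ ∘ a)
    inside a a<m with injective⊎collision a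
    ... | inj₂ (i , j , i<j , eq) = trans (V≈0⇒g≈0 a V≈0) (sym (trans (*-congˡ V≈0) (zeroʳ _)))
      where V≈0 = collision⇒0 α (fromℕ ∘ a) i<j (reflexive (≡.cong fromℕ eq))
    ... | inj₁ inj = trans (*-cong (∏-injective m a inj a<m (weight d fromℕ))
        (trans (evalForms-system-zeros α S _) (*-congˡ (evalForms-shift-cong S _ _
          (trans (sum-fromℕ a) (trans (reflexive (≡.cong fromℕ sum≡)) (sym sum-toℕ)))))))
        (solve 3 (λ w v z → w :* (v :* z) := (w :* z) :* v) refl W _ Z)
      where
      sum≡ : sumℕ a ≡ triangle m
      sum≡ = ℕ.≤-antisym (ℕ.≤-trans (sum≤triangle m a inj a<m) (ℕ.≤-reflexive
               (≡.trans (≡.cong (λ r → triangle m ℕ.+ r ℕ.* m) (ℕ.n∸n≡0 m)) (ℕ.+-identityʳ _))))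
               (triangle≤sum m a inj a<m)
    value : leadingCoeff m d α ≈ (W * Z) * V
    value = trans (gridDiff-uniform-system (dist d) m≤1+d α zeros zeros S (≡.trans (length-map _ (upTo N)) (length-upTo N)))
      (trans (Σgrid-restrict m g m≤1+d outside) (trans (Σgrid-cong m m inside) (Σgrid-* m m (W * Z) (λ a → twoVandermonde α (fromℕ ∘ a)))))

  -- The given sets and their restricted sums.

  sum-fromℤ : ∀ {n} (a : Fin n → ℤ) → sum (fromℤ ∘ a) ≈ fromℤ (sumℤ a)
  sum-fromℤ {zero}  a = refl
  sum-fromℤ {suc n} a = trans (+-congˡ (sum-fromℤ (a ∘ suc))) (sym (fromℤ-+ (a zero) _))

  dims-tabulate : ∀ n d (t : Fin n → ℕ → Carrier) → dims (Vec.tabulate (λ i → d , t i)) ≡ Vec.replicate n d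
  dims-tabulate zero    d t = ≡.refl
  dims-tabulate (suc n) d t = ≡.cong (d ∷_) (dims-tabulate n d (t ∘ suc))

  -- The Nullstellensatz step: a product vanishing on the whole grid has iterated divided difference
  -- 0, yet that number is the nonzero `leadingCoeff`. The points x are described pointwise because
  -- the grid builds its own functions.
  system-on-grid : ∀ {n} d → n ℕ.≤ suc d → ∀ α → (∀ i → 0# < α i) →
    (A : Fin n → List ℤ) → (∀ i → Unique (A i)) → (∀ i → length (A i) ≡ suc d) →
    ∀ e e′ S → length S ≡ (suc d ℕ.∸ n) ℕ.* n →
    ¬ (∀ a → (∀ i → a i ∈ A i) → ∀ x → (∀ i → x i ≡ fromℤ (a i)) → evalForms (system α e e′ S) x ≈ 0#)
  system-on-grid {n} d n≤1+d α α-pos A uniq len e e′ S lenS vanish = leadingCoeff-≉0 n d n≤1+d α α-pos (trans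
    (sym (gridDiff-system G (tabulate⁺ dist) (dims-tabulate n d t) n≤1+d α e e′ S lenS))
    (gridDiff-vanish G _ (λ x on → vanish (λ i → nth (A i) (proj₁ (node x on i))) (λ i → proj₁ (proj₂ (node x on i))) x
      (λ i → proj₂ (proj₂ (node x on i))))))
    where
    t : Fin n → ℕ → Carrier
    t i v = fromℤ (nth (A i) v)
    G : Vec Axis n
    G = Vec.tabulate (λ i → d , t i)
    bounded : ∀ i {v} → v ℕ.≤ d → v ℕ.< length (A i)
    bounded i v≤d = ≡.subst (_ ℕ.<_) (≡.sym (len i)) (s≤s v≤d)
    dist : ∀ i → Distinct (d , t i)
    dist i u v u≤d v≤d eq = nth-injective (uniq i) u v (bounded i u≤d) (bounded i v≤d) (fromℤ-injective _ _ eq)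
    node : ∀ x → (∀ i → ∃ λ v → v ℕ.≤ proj₁ (Vec.lookup G i) × x i ≡ proj₂ (Vec.lookup G i) v) →
      ∀ i → ∃ λ v → nth (A i) v ∈ A i × x i ≡ fromℤ (nth (A i) v)
    node x on i with on i
    ... | v , v≤d , eq rewrite lookup∘tabulate (λ i → d , t i) i = v , nth-∈ (A i) (bounded i v≤d) , eq

  module Restricted {n} (α : Fin n → Carrier) (b : Fin n → ℤ) (A : Fin n → List ℤ) (m : Fin n → Fin n → ℤ) where

    Conflict : (Fin n → ℤ) → Fin n → Fin n → Set ℓ₁
    Conflict a i j = fromℤ (a i) * α i ≈ fromℤ (a j) * α j ⊎ m i j ∣ ((a i ℤ.+ b i) ℤ.- (a j ℤ.+ b j))

    Conflicting : (Fin n → ℤ) → Set ℓ₁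
    Conflicting a = ∃₂ λ i j → i Fin.< j × Conflict a i j

    -- Trichotomy decides `_≈_` and divisibility is decidable, so the set of sums can be computed by
    -- filtering all choices.
    conflicting? : ∀ a → Dec (Conflicting a)
    conflicting? a = Fin.any? (λ i → Fin.any? (λ j → (i Fin.<? j) ×-dec ((_ ≟ _) ⊎-dec (m i j ∣? ((a i ℤ.+ b i) ℤ.- (a j ℤ.+ b j))))))

    restrictedSums : List ℤ
    restrictedSums = deduplicate ℤ._≟_ (map sumℤ (filter (¬? ∘ conflicting?) (choices A)))

    ∈-restrictedSums⁺ : ∀ {a} → a ∈ choices A → ¬ Conflicting a → sumℤ a ∈ restrictedSums
    ∈-restrictedSums⁺ a∈ free = ∈-deduplicate⁺ ℤ._≟_ (∈-map⁺ sumℤ (∈-filter⁺ (¬? ∘ conflicting?) a∈ free))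

    ∈-restrictedSums⁻ : ∀ {s} → s ∈ restrictedSums → ∃ λ a → (∀ i → a i ∈ A i) × ¬ Conflicting a × s ≡ sumℤ a
    ∈-restrictedSums⁻ s∈ with ∈-map⁻ sumℤ (∈-deduplicate⁻ ℤ._≟_ (map sumℤ (filter (¬? ∘ conflicting?) (choices A))) s∈)
    ... | a , a∈ , eq with ∈-filter⁻ (¬? ∘ conflicting?) {xs = choices A} a∈
    ...   | a∈choices , free = a , ∈-choices⁻ A a∈choices , free , eq

    module _ (α-pos : ∀ i → 0# < α i) (uniq : ∀ i → Unique (A i)) {d} (len : ∀ i → length (A i) ≡ suc d) (n≤1+d : n ℕ.≤ suc d)
      (small : ∀ i j → i Fin.< j → ∀ x y → x ∈ A i → y ∈ A j → (+ 2) ℤ.* (+ ∣ x ℤ.- y ∣) ℤ.< m i j) where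

      private
        excluded : ∀ i j → ∃ λ c → i Fin.< j → ∀ x y → x ∈ A i → y ∈ A j →
          m i j ∣ ((x ℤ.+ b i) ℤ.- (y ℤ.+ b j)) → x ℤ.- y ≡ c
        excluded i j with i Fin.<? j
        -- `e′` needs a constant for all i and j, but smallness is only available for i < j;
        -- elsewhere 0 fills in.
        ... | no  i≮j = + 0 , λ i<j → ⊥-elim (i≮j i<j)
        ... | yes i<j with excludedDifference (m i j) (b i) (b j) (A i) (A j) (small i j i<j)
        ...   | c , p = c , λ _ → p

      restrictedSums-length : (suc d ℕ.∸ n) ℕ.* n ℕ.< length restrictedSums
      restrictedSums-length = ℕ.≰⇒> λ few →
        system-on-grid d n≤1+d α α-pos A uniq len zeros e′ (S few) (length-S few) (vanish few)
        where
        e′ : Fin n → Fin n → Carrier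
        e′ i j = fromℤ (proj₁ (excluded i j))
        N : ℕ
        N = (suc d ℕ.∸ n) ℕ.* n
        S : length restrictedSums ℕ.≤ N → List Carrier
        -- Padded with zeros to exactly N entries, because the degree of the product must equal n·d;
        -- extra factors cannot spoil its vanishing.
        S _ = map fromℤ restrictedSums ++ replicate (N ℕ.∸ length restrictedSums) 0#
        length-S : ∀ few → length (S few) ≡ N
        length-S few = ≡.trans (length-++ (map fromℤ restrictedSums))
          (≡.trans (≡.cong₂ ℕ._+_ (length-map fromℤ restrictedSums) (length-replicate _)) (ℕ.m+[n∸m]≡n few))
        vanish-at : ∀ few a → a ∈ choices A → evalForms (system α zeros e′ (S few)) (fromℤ ∘ a) ≈ 0#
        vanish-at few a a∈ with conflicting? a
        ... | yes (i , j , i<j , inj₁ eq) = trans (evalForms-system α zeros e′ (S few) _) (trans (*-congʳ (trans (*-congʳ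
                (evalForms-pairs-vanish α zeros (fromℤ ∘ a) i<j (x≈y⇒x-y≈0 (trans (*-comm _ _) (trans eq (*-comm _ _))))))
                (zeroˡ _))) (zeroˡ _))
        ... | yes (i , j , i<j , inj₂ m∣) = trans (evalForms-system α zeros e′ (S few) _) (trans (*-congʳ (trans (*-congˡ
                (evalForms-pairs-vanish ones e′ (fromℤ ∘ a) i<j
                  (trans (+-cong (*-identityˡ _) (-‿cong (*-identityˡ _))) (trans (sym (fromℤ-minus (a i) (a j)))
                    (reflexive (≡.cong fromℤ (proj₂ (excluded i j) i<j _ _ (∈-choices⁻ A a∈ i) (∈-choices⁻ A a∈ j) m∣)))))))
                (zeroʳ _))) (zeroˡ _))
        ... | no free = trans (evalForms-system α zeros e′ (S few) _) (trans (*-congˡ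
                (evalForms-shift-vanish (fromℤ ∘ a) (∈-++⁺ˡ (∈-map⁺ fromℤ (∈-restrictedSums⁺ a∈ free))) (sum-fromℤ a)))
                (zeroʳ _))
        vanish : ∀ few a → (∀ i → a i ∈ A i) → ∀ x → (∀ i → x i ≡ fromℤ (a i)) → evalForms (system α zeros e′ (S few)) x ≈ 0#
        vanish few a a∈ x x≡ with ∈-choices⁺ A a a∈
        ... | b , b∈ , b≗a = trans (evalForms-cong (system α zeros e′ (S few)) x (fromℤ ∘ b)
          (λ i → reflexive (≡.trans (x≡ i) (≡.cong fromℤ (≡.sym (b≗a i)))))) (vanish-at few b b∈)

open import Data.Fin using (_<_)

theorem1p3 : ∀ {c ℓ₁ ℓ₂ : Level} (F : OrderedField c ℓ₁ ℓ₂) (n k : ℕ)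
    (α : Fin n → OrderedField.Carrier F)
    (b : Fin n → ℤ)
    (A : Fin n → List ℤ)
    (m : Fin n → Fin n → ℤ) →
    (∀ i → OrderedField._<_ F (OrderedField.0# F) (α i)) →
    (∀ i → Unique (A i)) →
    (∀ i → length (A i) ≡ k) →
    0 ℕ.< k →
    (∀ i j → i < j → ∀ x y → x ∈ A i → y ∈ A j →
    (+ 2) ℤ.* (+ ∣ x ℤ.- y ∣) ℤ.< m i j) →
    ∃ λ (S : List ℤ) → Unique S ×
    ((+ k ℤ.- + n) ℤ.* (+ n) ℤ.< + length S) ×
    All (λ s → ∃ λ (a : Fin n → ℤ) →
    (∀ i → a i ∈ A i) ×
    (∀ i j → i < j →
    ¬ (OrderedField._≈_ F
    (OrderedField._*_ F (OrderedField.fromℤ F (a i)) (α i))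
    (OrderedField._*_ F (OrderedField.fromℤ F (a j)) (α j)))
    × ¬ (m i j ∣ ((a i ℤ.+ b i) ℤ.- (a j ℤ.+ b j)))) ×
    s ≡ sumℤ a) S
-- Since k > 0, write k = d + 1, where d is the exponent read off by k nodes.
theorem1p3 F n (suc d) α b A m α-pos uniq len _ small =
  restrictedSums , deduplicate-! _ , bound , All.tabulate restricted
  where
  open Coefficient.Restricted F α b A m
  bound : (+ suc d ℤ.- + n) ℤ.* (+ n) ℤ.< + length restrictedSums
  bound with n ℕ.≤? suc d
  ... | yes n≤k = n≤k⇒[k-n]n<l n≤k (restrictedSums-length α-pos uniq len n≤k small)
  ... | no  n≰k = k<n⇒[k-n]n<l (ℕ.≰⇒> n≰k) _
  restricted : ∀ {s} → s ∈ restrictedSums → _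
  restricted s∈ with ∈-restrictedSums⁻ s∈
  ... | a , a∈ , free , eq =
    a , a∈ , (λ i j i<j → (λ p → free (i , j , i<j , inj₁ p)) , (λ p → free (i , j , i<j , inj₂ p))) , eq
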